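{- Let $R$ be a unique factorization domain and $f$ a primitive Dirichlet polynomial with coefficients in $R$, of degree $n\ge2$, with $n$ not square-free. Fix an arbitrary integer $m\ge2$. Then the following are equivalent: (i) $f$ is square-free; (ii) for every prime factor $p$ of $n$ with multiplicity at least $2$ and every Dirichlet polynomial $g$ with coefficients in $R$ of degree at most $n/p$, $g^m$ is not divisible by $f$; (iii) for every prime factor $p$ of $n$ with multiplicity at least $2$ and every Dirichlet polynomial $g$ with coefficients in $R$ of degree exactly $n/p$, $g^m$ is not divisible by $f$.
   Context: Dirichlet polynomials over $R$ (finite sums $\sum_i\frac{a_i}{i^s}$) form a unique factorization domain under termwise addition and the Dirichlet product $\left(\sum_j\frac{b_j}{j^s}\right)\left(\sum_k\frac{c_k}{k^s}\right)=\sum_i\frac{\sum_{jk=i}b_jc_k}{i^s}$; divisibility refers to this ring. The degree is the largest index with nonzero coefficient. $f$ is primitive if its coefficients are coprime in $R$, and square-free if it has no repeated irreducible factors (including irreducible elements of $R$). -}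

module Defs where

open import Level using (Level; _⊔_)
open import Algebra.Bundles using (CommutativeRing)
open import Data.Nat as ℕ using (ℕ; zero; suc)
open import Data.Nat.Divisibility using (_∣?_)
open import Data.Nat.DivMod using (_/_)
open import Data.Nat.Primality using (Prime)
open import Data.List using (List; []; _∷_; map; upTo; length; lookup)
open import Data.List.Relation.Unary.All using (All)
open import Data.Fin using (Fin)
open import Data.Product using (Σ; ∃; _×_; _,_)
open import Data.Sum using (_⊎_)
open import Relation.Nullary using (¬_; does)
open import Data.Bool using (if_then_else_)
open import Function.Bundles using (_↔_; Inverse)

module Theory {c ℓ : Level} (R : CommutativeRing c ℓ) where
  open CommutativeRing R

  _∣R_ : Carrier → Carrier → Set (c ⊔ ℓ)
  a ∣R b = ∃ λ d → a * d ≈ b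

  IsUnitR : Carrier → Set (c ⊔ ℓ)
  IsUnitR a = ∃ λ d → a * d ≈ 1#

  AssociatedR : Carrier → Carrier → Set (c ⊔ ℓ)
  AssociatedR a b = ∃ λ u → IsUnitR u × (a * u ≈ b)

  IrreducibleR : Carrier → Set (c ⊔ ℓ)
  IrreducibleR a = (¬ (a ≈ 0#)) × (¬ IsUnitR a)
                 × (∀ x y → x * y ≈ a → IsUnitR x ⊎ IsUnitR y)

  productR : List Carrier → Carrier
  productR []       = 1#
  productR (x ∷ xs) = x * productR xs

  IsIntegralDomain : Set (c ⊔ ℓ)
  IsIntegralDomain = (¬ (1# ≈ 0#)) × (∀ x y → x * y ≈ 0# → (x ≈ 0#) ⊎ (y ≈ 0#))

  IsUFD : Set (c ⊔ ℓ)
  IsUFD = IsIntegralDomain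
        × (∀ a → ¬ (a ≈ 0#) → ¬ IsUnitR a →
             ∃ λ (xs : List Carrier) → All IrreducibleR xs × (productR xs ≈ a))
        × (∀ (xs ys : List Carrier) → All IrreducibleR xs → All IrreducibleR ys →
             productR xs ≈ productR ys →
             Σ (Fin (length xs) ↔ Fin (length ys)) λ π →
               ∀ i → AssociatedR (lookup xs i) (lookup ys (Inverse.to π i)))

  -- Dirichlet polynomials over R.
  -- A Dirichlet polynomial  Σ_i a_i / i^s  is represented by its coefficient
  -- function  a : ℕ → Carrier  (the value at index 0 is ignored) together with
  -- the side condition `Finite a` (only finitely many nonzero coefficients).

  DSeries : Set c
  DSeries = ℕ → Carrier

  Finite : DSeries → Set ℓ
  Finite a = ∃ λ N → ∀ i → N ℕ.< i → a i ≈ 0#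

  sumR : List Carrier → Carrier
  sumR []       = 0#
  sumR (x ∷ xs) = x + sumR xs

  _⋆_ : DSeries → DSeries → DSeries
  (a ⋆ b) i = sumR (map term (upTo i))
    where
    term : ℕ → Carrier
    term k = if does (suc k ∣? i) then a (suc k) * b (i / suc k) else 0#

  oneD : DSeries
  oneD zero          = 0#
  oneD (suc zero)    = 1#
  oneD (suc (suc _)) = 0#

  _^D_ : DSeries → ℕ → DSeries
  a ^D zero  = oneD
  a ^D suc m = a ⋆ (a ^D m)

  _≈D_ : DSeries → DSeries → Set ℓ
  a ≈D b = ∀ i → 1 ℕ.≤ i → a i ≈ b i

  IsZeroD : DSeries → Set ℓ
  IsZeroD a = ∀ i → 1 ℕ.≤ i → a i ≈ 0#

  HasDegree : DSeries → ℕ → Set ℓ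
  HasDegree a n = (1 ℕ.≤ n) × (¬ (a n ≈ 0#)) × (∀ i → n ℕ.< i → a i ≈ 0#)

  -- degree at most k (for a nonzero polynomial)
  DegreeAtMost : DSeries → ℕ → Set ℓ
  DegreeAtMost a k = ∀ i → k ℕ.< i → a i ≈ 0#

  _∣D_ : DSeries → DSeries → Set (c ⊔ ℓ)
  a ∣D b = ∃ λ h → Finite h × ((a ⋆ h) ≈D b)

  IsUnitD : DSeries → Set (c ⊔ ℓ)
  IsUnitD a = ∃ λ h → Finite h × ((a ⋆ h) ≈D oneD)

  IrreducibleD : DSeries → Set (c ⊔ ℓ)
  IrreducibleD q = Finite q × (¬ IsZeroD q) × (¬ IsUnitD q)
                 × (∀ x y → Finite x → Finite y → (x ⋆ y) ≈D q → IsUnitD x ⊎ IsUnitD y)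

  -- square-free: no repeated irreducible factor (irreducible constants from R
  -- are irreducible elements of the Dirichlet polynomial ring, so covered)
  SquareFreeD : DSeries → Set (c ⊔ ℓ)
  SquareFreeD f = ∀ q → IrreducibleD q → ¬ ((q ⋆ q) ∣D f)

  PrimitiveD : DSeries → Set (c ⊔ ℓ)
  PrimitiveD f = ∀ r → (∀ i → 1 ℕ.≤ i → r ∣R f i) → IsUnitR r

NotSquareFreeℕ : ℕ → Set
NotSquareFreeℕ n = ∃ λ p → Prime p × (p ℕ.* p Data.Nat.Divisibility.∣ n)

{-# OPTIONS --safe #-}

-- Let f be square-free and f ∣ g^m with g ≠ 0.  Dirichlet polynomials supported on
-- integers all of whose prime factors are < k form a subring; passing from a prime
-- k = p to p + 1 adjoins the indeterminate 1/p^s, so Gauss's argument shows by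
-- induction on k that every nonzero element of such a subring is a unit times a
-- product of primes.  Each prime dividing f divides g^m, hence g, and as no prime
-- square divides f this gives f ∣ g, so n ≤ deg g: this contradicts deg g ≤ n/p.
-- Conversely, if f = q²h with q irreducible, then q is not constant (f is primitive),
-- and for a prime p ∣ deg q a multiple of q h by a monomial has degree exactly n/p,
-- while its square is already divisible by f.
--
-- Since all three conditions are negations, case distinctions on undecidable
-- propositions are made inside the double-negation monad.
module Submission where

open import Defs
open import Level using (Level; _⊔_)
open import Algebra.Bundles using (CommutativeRing)
import Algebra.Properties.Ring as RingProperties
import Algebra.Properties.Semiring.Sum as Sum
import Algebra.Solver.Ring.NaturalCoefficients.Default as SemiringSolver
open import Data.Bool using (if_then_else_)
open import Data.Empty using (⊥-elim)
open import Data.Fin using (zero; suc; toℕ)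
import Data.Fin.Properties as Fin
open import Data.List using ([]; _∷_; _++_; applyUpTo; lookup; map; upTo)
open import Data.List.Properties using (map-upTo)
open import Data.List.Relation.Unary.All using (All; []; _∷_)
open import Data.List.Relation.Unary.All.Properties using (++⁺)
open import Data.Nat as ℕ using (ℕ; zero; suc; s≤s; z≤n)
open import Data.Nat.Divisibility as ℕ using (divides; _∣?_)
open import Data.Nat.DivMod using (_/_; m*n/n≡m)
open import Data.Nat.ListAction using (product)
open import Data.Nat.Primality using (Prime; prime?; ¬prime[0]; ¬prime[1]; euclidsLemma; prime⇒nonZero)
open import Data.Nat.Primality.Factorisation using (factorise; module PrimeFactorisation)
import Data.Nat.Properties as ℕ
open import Data.Product using (∃; ∃₂; _×_; _,_; proj₁; proj₂)
open import Data.Sum using (_⊎_; inj₁; inj₂; [_,_]′)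
open import Function using (_∘_)
open import Function.Bundles using (Inverse)
open import Relation.Binary.Definitions using (tri<; tri≈; tri>)
open import Relation.Binary.PropositionalEquality as ≡ using (_≡_; _≢_)
import Relation.Binary.Reasoning.Setoid as SetoidReasoning
open import Relation.Nullary using (¬_; Dec; yes; no; does)
open import Relation.Nullary.Decidable using (¬¬-excluded-middle)

-- The usual form of Gauss's argument takes gcds for contents and the field of fractions for
-- Euclidean division. Neither is formed here: contents come from stripping primes off a leading
-- coefficient, and pseudo-division in an ideal with two generators clears denominators by constant
-- multipliers. Factorisations are into primes rather than irreducibles, since primality can be used
-- directly on a product and Gauss's lemma carries it from one stage to the next. The stages are
-- predicates on one fixed ring, so their elements are compared without embeddings. Two notions of
-- factor meet at the end: primes are relative to a stage, whereas square-freeness speaks of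
-- irreducibles of the whole ring, whose defining disjunction is not doubly negated.
-- Multiplicativity of the degree bridges the gap.

infixl 1 _>>=_
-- The result is an arbitrary negation `¬ B`, of which `¬ ¬ C` is the case `B = ¬ C`; one `do` block
-- can thus end in either form.
_>>=_ : ∀ {a b} {A : Set a} {B : Set b} → ¬ ¬ A → (A → ¬ B) → ¬ B
(m >>= k) b = m λ a → k a b

return : ∀ {a} {A : Set a} → A → ¬ ¬ A
return a k = k a

-- Divisibility, primes and polynomials relative to a subring

module _ {c ℓ} (T : CommutativeRing c ℓ) where
  open CommutativeRing T hiding (zero)

  NoZeroDivisors : Set (c ⊔ ℓ)
  NoZeroDivisors = ∀ x y → x * y ≈ 0# → x ≈ 0# ⊎ y ≈ 0#

  Nontrivial : Set ℓ
  Nontrivial = ¬ 1# ≈ 0#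

  record IsSubring {s} (S : Carrier → Set s) : Set (c ⊔ ℓ ⊔ s) where
    field
      resp : ∀ {a b} → a ≈ b → S a → S b
      0∈   : S 0#
      1∈   : S 1#
      +∈   : ∀ {a b} → S a → S b → S (a + b)
      *∈   : ∀ {a b} → S a → S b → S (a * b)
      -∈   : ∀ {a} → S a → S (- a)

  module Divisibility {s} (S : Carrier → Set s) where
    infix 4 _∣_

    _∣_ : Carrier → Carrier → Set (c ⊔ ℓ ⊔ s)
    a ∣ b = ∃ λ d → S d × a * d ≈ b

    -- `split` is doubly negated because divisibility is not assumed decidable: nothing tells which
    -- of the two factors is divisible.
    record IsPrime (π : Carrier) : Set (c ⊔ ℓ ⊔ s) where
      field
        ∈S      : S π
        ≉0      : ¬ π ≈ 0#
        nonunit : ¬ π ∣ 1#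
        split   : ∀ {a b} → S a → S b → π ∣ a * b → ¬ ¬ (π ∣ a ⊎ π ∣ b)

    data Factorisation (a : Carrier) : Set (c ⊔ ℓ ⊔ s) where
      unit : a ∣ 1# → Factorisation a
      cons : ∀ {π b} → IsPrime π → S b → Factorisation b → π * b ≈ a → Factorisation a

    PrimeFactorial : Set (c ⊔ ℓ ⊔ s)
    PrimeFactorial = ∀ a → S a → ¬ a ≈ 0# → ¬ ¬ Factorisation a

  -- Two predicates with the same elements still give formally different notions of prime. This
  -- arises when `k` is not prime, where `Smooth k` and `Smooth (suc k)` agree.
  module SameSubring {s s′} {S : Carrier → Set s} {S′ : Carrier → Set s′}
    (to : ∀ {a} → S a → S′ a) (from : ∀ {a} → S′ a → S a) where
    open Divisibility S
    open Divisibility S′ using () renaming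
      ( _∣_ to _∣′_; IsPrime to IsPrime′; Factorisation to Factorisation′
      ; unit to unit′; cons to cons′; PrimeFactorial to PrimeFactorial′)

    ∣-to : ∀ {a b} → a ∣ b → a ∣′ b
    ∣-to (d , d∈ , eq) = d , to d∈ , eq

    ∣-from : ∀ {a b} → a ∣′ b → a ∣ b
    ∣-from (d , d∈ , eq) = d , from d∈ , eq

    IsPrime-to : ∀ {π} → IsPrime π → IsPrime′ π
    IsPrime-to p = record
      { ∈S      = to ∈S
      ; ≉0      = ≉0
      ; nonunit = nonunit ∘ ∣-from
      ; split   = λ a∈ b∈ π∣ab → split (from a∈) (from b∈) (∣-from π∣ab) >>= λ
          { (inj₁ π∣a) → return (inj₁ (∣-to π∣a)) ; (inj₂ π∣b) → return (inj₂ (∣-to π∣b)) }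
      }
      where open IsPrime p

    Factorisation-to : ∀ {a} → Factorisation a → Factorisation′ a
    Factorisation-to (unit a∣1) = unit′ (∣-to a∣1)
    Factorisation-to (cons p b∈ φ eq) = cons′ (IsPrime-to p) (to b∈) (Factorisation-to φ) eq

    PrimeFactorial-to : PrimeFactorial → PrimeFactorial′
    PrimeFactorial-to pf a a∈ a≉0 = pf a (from a∈) a≉0 >>= λ φ → return (Factorisation-to φ)

  module Polynomials {s} (S : Carrier → Set s) (x : Carrier) where

    -- Poly n a: a is a polynomial in x of degree < n over S, in Horner form.
    data Poly : ℕ → Carrier → Set (c ⊔ ℓ ⊔ s) where
      pzero : ∀ {a} → a ≈ 0# → Poly zero a
      psuc  : ∀ {n c a b} → S c → Poly n b → c + x * b ≈ a → Poly (suc n) a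

-- Cancellation and factorisations in an integral domain

module IntegralDomain {c ℓ} (T : CommutativeRing c ℓ)
  (noZeroDivisors : NoZeroDivisors T) (1≉0 : Nontrivial T) where

  open CommutativeRing T hiding (zero)
  open RingProperties ring using (-‿distribˡ-*; -‿distribʳ-*; x∙y⁻¹≈ε⇒x≈y)
  open SemiringSolver commutativeSemiring using (solve; _:+_; _:*_; _:=_)
  open SetoidReasoning setoid

  *-≉0 : ∀ {x y} → ¬ x ≈ 0# → ¬ y ≈ 0# → ¬ x * y ≈ 0#
  *-≉0 x≉0 y≉0 xy≈0 with noZeroDivisors _ _ xy≈0
  ... | inj₁ x≈0 = x≉0 x≈0
  ... | inj₂ y≈0 = y≉0 y≈0

  *-≉0ˡ : ∀ {x y} → ¬ x * y ≈ 0# → ¬ x ≈ 0#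
  *-≉0ˡ xy≉0 x≈0 = xy≉0 (trans (*-congʳ x≈0) (zeroˡ _))

  *-cancelˡ : ∀ {x y z} → ¬ x ≈ 0# → x * y ≈ x * z → y ≈ z
  *-cancelˡ {x} {y} {z} x≉0 xy≈xz with noZeroDivisors x (y - z) x[y-z]≈0
    where
    x[y-z]≈0 : x * (y - z) ≈ 0#
    x[y-z]≈0 = begin
      x * (y - z)         ≈⟨ distribˡ x y (- z) ⟩
      x * y + x * - z     ≈⟨ +-cong xy≈xz (sym (-‿distribʳ-* x z)) ⟩
      x * z - x * z       ≈⟨ -‿inverseʳ _ ⟩
      0#                  ∎
  ... | inj₁ x≈0   = ⊥-elim (x≉0 x≈0)
  ... | inj₂ y-z≈0 = x∙y⁻¹≈ε⇒x≈y y z y-z≈0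

  module Factorisations {s} {S : Carrier → Set s} (subring : IsSubring T S) where
    open IsSubring subring
    open Divisibility T S

    ∣-resp : ∀ {a b d} → a ∣ b → b ≈ d → a ∣ d
    ∣-resp (e , e∈ , ae≈b) b≈d = e , e∈ , trans ae≈b b≈d

    ∣-trans : ∀ {a b d} → a ∣ b → b ∣ d → a ∣ d
    ∣-trans (e , e∈ , ae≈b) (f , f∈ , bf≈d) =
      e * f , *∈ e∈ f∈ , trans (sym (*-assoc _ e f)) (trans (*-congʳ ae≈b) bf≈d)

    ∣-*ʳ : ∀ {a b d} → S d → a ∣ b → a ∣ b * d
    ∣-*ʳ d∈ a∣b = ∣-trans a∣b (_ , d∈ , refl)

    ∣-*ˡ : ∀ {a b d} → S d → a ∣ b → a ∣ d * b
    ∣-*ˡ d∈ a∣b = ∣-resp (∣-*ʳ d∈ a∣b) (*-comm _ _)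

    ∣-cancelˡ : ∀ {x a b} → ¬ x ≈ 0# → x * a ∣ x * b → a ∣ b
    ∣-cancelˡ x≉0 (e , e∈ , xae≈xb) =
      e , e∈ , *-cancelˡ x≉0 (trans (sym (*-assoc _ _ e)) xae≈xb)

    unit-*-factorisation : ∀ {u b} → S u → u ∣ 1# → Factorisation b → Factorisation (u * b)
    unit-*-factorisation {u} {b} u∈ (v , v∈ , uv≈1) (unit (e , e∈ , be≈1)) = unit (v * e , *∈ v∈ e∈ , (begin
      (u * b) * (v * e)   ≈⟨ solve 4 (λ u b v e → (u :* b) :* (v :* e) := (u :* v) :* (b :* e)) refl u b v e ⟩
      (u * v) * (b * e)   ≈⟨ *-cong uv≈1 be≈1 ⟩
      1# * 1#             ≈⟨ *-identityˡ 1# ⟩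
      1#                  ∎))
    unit-*-factorisation {u} u∈ u∣1 (cons {π} {b} p b∈ φ πb≈a) =
      cons p (*∈ u∈ b∈) (unit-*-factorisation u∈ u∣1 φ)
        (trans (solve 3 (λ p u b → p :* (u :* b) := u :* (p :* b)) refl π u b) (*-congˡ πb≈a))

    *-factorisation : ∀ {a b} → S a → S b → Factorisation a → Factorisation b → Factorisation (a * b)
    *-factorisation a∈ b∈ (unit a∣1) ψ = unit-*-factorisation a∈ a∣1 ψ
    *-factorisation {b = b} a∈ b∈ (cons {π} {a′} p a′∈ φ πa′≈a) ψ =
      cons p (*∈ a′∈ b∈) (*-factorisation a′∈ b∈ φ ψ) (trans (sym (*-assoc π a′ b)) (*-congʳ πa′≈a))

    factorisation-resp : ∀ {a b} → a ≈ b → Factorisation a → Factorisation b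
    factorisation-resp a≈b (unit (e , e∈ , ae≈1)) = unit (e , e∈ , trans (*-congʳ (sym a≈b)) ae≈1)
    factorisation-resp a≈b (cons p c∈ φ πc≈a) = cons p c∈ φ (trans πc≈a a≈b)

  -- Polynomial extensions: Horner forms and degrees

  module Extension {s s′} {S : Carrier → Set s} {S′ : Carrier → Set s′}
    (subring : IsSubring T S) (subring′ : IsSubring T S′)
    (x : Carrier) (x∈S′ : S′ x) (S⊆S′ : ∀ {a} → S a → S′ a)
    (polynomial : ∀ {a} → S′ a → ∃ λ n → Polynomials.Poly T S x n a)
    -- A single Horner step of algebraic independence; iterated along a Horner form it makes all
    -- coefficients unique.
    (transcendental : ∀ {c b} → S c → S′ b → c + x * b ≈ 0# → (c ≈ 0#) × (b ≈ 0#)) where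

    open IsSubring subring
    open IsSubring subring′ using () renaming
      (resp to resp′; 0∈ to 0∈′; 1∈ to 1∈′; +∈ to +∈′; *∈ to *∈′; -∈ to -∈′)
    open Polynomials T S x
    open Divisibility T S
    open Divisibility T S′ using () renaming
      ( _∣_ to _∣′_; IsPrime to IsPrime′; Factorisation to Factorisation′
      ; unit to unit′; cons to cons′; PrimeFactorial to PrimeFactorial′)
    open Factorisations subring
    open Factorisations subring′ using () renaming
      ( ∣-resp to ∣′-resp; ∣-trans to ∣′-trans; ∣-*ʳ to ∣′-*ʳ; ∣-*ˡ to ∣′-*ˡ
      ; *-factorisation to *-factorisation′; factorisation-resp to factorisation-resp′)

    ∣⇒∣′ : ∀ {a b} → a ∣ b → a ∣′ b
    ∣⇒∣′ (d , d∈ , ad≈b) = d , S⊆S′ d∈ , ad≈b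

    Poly⇒S′ : ∀ {n a} → Poly n a → S′ a
    Poly⇒S′ (pzero a≈0) = resp′ (sym a≈0) 0∈′
    Poly⇒S′ (psuc c∈ p eq) = resp′ eq (+∈′ (S⊆S′ c∈) (*∈′ x∈S′ (Poly⇒S′ p)))

    Poly-resp : ∀ {n a b} → a ≈ b → Poly n a → Poly n b
    Poly-resp a≈b (pzero a≈0) = pzero (trans (sym a≈b) a≈0)
    Poly-resp a≈b (psuc c∈ p eq) = psuc c∈ p (trans eq a≈b)

    Poly-zero : ∀ n {a} → a ≈ 0# → Poly n a
    Poly-zero zero a≈0 = pzero a≈0
    Poly-zero (suc n) a≈0 = psuc 0∈ (Poly-zero n refl) (trans (trans (+-identityˡ _) (zeroʳ x)) (sym a≈0))

    Poly-mono : ∀ {m n a} → m ℕ.≤ n → Poly m a → Poly n a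
    Poly-mono _ (pzero a≈0) = Poly-zero _ a≈0
    Poly-mono (s≤s m≤n) (psuc c∈ p eq) = psuc c∈ (Poly-mono m≤n p) eq

    Poly-x* : ∀ {n a} → Poly n a → Poly (suc n) (x * a)
    Poly-x* p = psuc 0∈ p (+-identityˡ _)

    Poly-const : ∀ {n c} → S c → Poly (suc n) c
    Poly-const {n} c∈ = psuc c∈ (Poly-zero n refl) (trans (+-congˡ (zeroʳ x)) (+-identityʳ _))

    Poly-+ : ∀ {n a b} → Poly n a → Poly n b → Poly n (a + b)
    Poly-+ (pzero a≈0) (pzero b≈0) = pzero (trans (+-cong a≈0 b≈0) (+-identityˡ 0#))
    Poly-+ (psuc {c = c} {b = a} c∈ p eq) (psuc {c = d} {b = b} d∈ q eq′) = psuc (+∈ c∈ d∈) (Poly-+ p q)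
      (trans (solve 5 (λ c d x a b → (c :+ d) :+ x :* (a :+ b) := (c :+ x :* a) :+ (d :+ x :* b)) refl c d x a b)
        (+-cong eq eq′))

    Poly-scale : ∀ {n s a} → S s → Poly n a → Poly n (s * a)
    Poly-scale s∈ (pzero a≈0) = pzero (trans (*-congˡ a≈0) (zeroʳ _))
    Poly-scale {s = s} s∈ (psuc {c = c} {b = b} c∈ p eq) = psuc (*∈ s∈ c∈) (Poly-scale s∈ p)
      (trans (solve 4 (λ s c x b → s :* c :+ x :* (s :* b) := s :* (c :+ x :* b)) refl s c x b) (*-congˡ eq))

    Poly-* : ∀ {n m a b} → Poly n a → Poly (suc m) b → Poly (n ℕ.+ m) (a * b)
    Poly-* {b = b} (pzero a≈0) q = Poly-zero _ (trans (*-congʳ a≈0) (zeroˡ b))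
    Poly-* {suc n} {m} {b = b} (psuc {c = c} {b = a′} c∈ p eq) q = Poly-resp
      (trans (solve 4 (λ c x a b → c :* b :+ x :* (a :* b) := (c :+ x :* a) :* b) refl c x a′ b) (*-congʳ eq))
      (Poly-+ (Poly-mono (s≤s (ℕ.m≤n+m m n)) (Poly-scale c∈ q)) (Poly-x* (Poly-* p q)))

    x^_ : ℕ → Carrier
    x^ zero  = 1#
    x^ suc n = x * x^ n

    x^-+ : ∀ m n → x^ (m ℕ.+ n) ≈ x^ m * x^ n
    x^-+ zero n = sym (*-identityˡ _)
    x^-+ (suc m) n = trans (*-congˡ (x^-+ m n)) (sym (*-assoc x _ _))

    x^∈S′ : ∀ n → S′ (x^ n)
    x^∈S′ zero    = 1∈′
    x^∈S′ (suc n) = *∈′ x∈S′ (x^∈S′ n)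

    Poly-*x^ : ∀ k {n a} → Poly n a → Poly (k ℕ.+ n) (a * x^ k)
    Poly-*x^ zero p = Poly-resp (sym (*-identityʳ _)) p
    Poly-*x^ (suc k) {a = a} p = Poly-resp
      (solve 3 (λ x a y → x :* (a :* y) := a :* (x :* y)) refl x a (x^ k)) (Poly-x* (Poly-*x^ k p))

    Poly-leading : ∀ {n a} → Poly (suc n) a → ∃₂ λ s a′ → S s × Poly n a′ × (s * x^ n + a′ ≈ a)
    Poly-leading {zero} {a} (psuc {c = c} {b = b} c∈ (pzero b≈0) eq) = c , 0# , c∈ , pzero refl , (begin
      c * 1# + 0#   ≈⟨ +-cong (*-identityʳ c) (sym (trans (*-congˡ b≈0) (zeroʳ x))) ⟩
      c + x * b     ≈⟨ eq ⟩
      a             ∎)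
    Poly-leading {suc n} {a} (psuc {c = c} {b = b} c∈ p eq) with Poly-leading p
    ... | s , b′ , s∈ , q , eq′ = s , c + x * b′ , s∈ , psuc c∈ q refl , (begin
      s * (x * x^ n) + (c + x * b′)
        ≈⟨ solve 5 (λ s x y c b → s :* (x :* y) :+ (c :+ x :* b) := c :+ x :* (s :* y :+ b)) refl s x (x^ n) c b′ ⟩
      c + x * (s * x^ n + b′)   ≈⟨ +-congˡ (*-congˡ eq′) ⟩
      c + x * b                 ≈⟨ eq ⟩
      a                         ∎)

    -- If `s * x^ (suc n)` equals `c + x * b`, transcendence forces `b ≈ s * x^ n`, so the claim
    -- descends until the bound is zero. This is what makes the degree well defined.
    monomial-degree : ∀ n {s} → S s → Poly n (s * x^ n) → s ≈ 0#
    monomial-degree zero s∈ (pzero eq) = trans (sym (*-identityʳ _)) eq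
    monomial-degree (suc n) {s} s∈ (psuc {c = c} {b = b} c∈ p eq) = monomial-degree n s∈
      (Poly-resp (x∙y⁻¹≈ε⇒x≈y b sxⁿ (proj₂ (transcendental c∈ b-sxⁿ∈ vanishes))) p)
      where
      sxⁿ : Carrier
      sxⁿ = s * x^ n
      b-sxⁿ∈ : S′ (b - sxⁿ)
      b-sxⁿ∈ = +∈′ (Poly⇒S′ p) (-∈′ (*∈′ (S⊆S′ s∈) (x^∈S′ n)))
      vanishes : c + x * (b - sxⁿ) ≈ 0#
      vanishes = begin
        c + x * (b - sxⁿ)                ≈⟨ solve 4 (λ c x b m → c :+ x :* (b :+ m) := (c :+ x :* b) :+ x :* m) refl c x b (- sxⁿ) ⟩
        (c + x * b) + x * (- sxⁿ)        ≈⟨ +-congʳ eq ⟩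
        s * (x * x^ n) + x * (- sxⁿ)     ≈⟨ solve 4 (λ s x y m → s :* (x :* y) :+ x :* m := x :* (s :* y :+ m)) refl s x (x^ n) (- sxⁿ) ⟩
        x * (sxⁿ - sxⁿ)                  ≈⟨ *-congˡ (-‿inverseʳ sxⁿ) ⟩
        x * 0#                           ≈⟨ zeroʳ x ⟩
        0#                               ∎

    -- In contrast to the upper bound `Poly`, a leading coefficient known to be nonzero is
    -- exhibited; for a nonzero element this is available only up to double negation.
    Degree : ℕ → Carrier → Set _
    Degree n a = ∃₂ λ s a′ → S s × (¬ s ≈ 0#) × Poly n a′ × (s * x^ n + a′ ≈ a)

    Degree⇒Poly : ∀ {n a} → Degree n a → Poly (suc n) a
    Degree⇒Poly {n} (s , a′ , s∈ , _ , p , eq) = Poly-resp eq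
      (Poly-+ (≡.subst (λ k → Poly k (s * x^ n)) (ℕ.+-comm n 1) (Poly-*x^ n (Poly-const s∈))) (Poly-mono (ℕ.n≤1+n n) p))

    Poly⇒Degree : ∀ {n a} → Poly n a → ¬ a ≈ 0# → ¬ ¬ ∃ λ m → Degree m a
    Poly⇒Degree (pzero a≈0) a≉0 = ⊥-elim (a≉0 a≈0)
    Poly⇒Degree {suc n} p a≉0 with Poly-leading p
    ... | s , a′ , s∈ , q , eq = do
      no s≉0 ← ¬¬-excluded-middle {A = s ≈ 0#}
        where yes s≈0 → Poly⇒Degree (Poly-resp (trans (sym (drop s≈0)) eq) q) a≉0
      return (n , s , a′ , s∈ , s≉0 , q , eq)
      where
      drop : s ≈ 0# → s * x^ n + a′ ≈ a′
      drop s≈0 = trans (+-congʳ (trans (*-congʳ s≈0) (zeroˡ _))) (+-identityˡ a′)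

    Degree⇒≰ : ∀ {n a} → Degree n a → ¬ Poly n a
    Degree⇒≰ {n} {a} (s , a′ , s∈ , s≉0 , p , eq) q = s≉0 (monomial-degree n s∈ (Poly-resp (begin
      a - a′                   ≈⟨ +-congʳ (sym eq) ⟩
      (s * x^ n + a′) - a′     ≈⟨ +-assoc _ a′ (- a′) ⟩
      s * x^ n + (a′ - a′)     ≈⟨ +-congˡ (-‿inverseʳ a′) ⟩
      s * x^ n + 0#            ≈⟨ +-identityʳ _ ⟩
      s * x^ n                 ∎) (Poly-+ q (Poly-neg p))))
      where
      Poly-neg : ∀ {n a} → Poly n a → Poly n (- a)
      Poly-neg {a = a} r = Poly-resp (trans (sym (-‿distribˡ-* 1# a)) (-‿cong (*-identityˡ a))) (Poly-scale (-∈ 1∈) r)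

    Degree-* : ∀ {m n a b} → Degree m a → Degree n b → Degree (m ℕ.+ n) (a * b)
    Degree-* {m} {n} {a} {b} (s , a′ , s∈ , s≉0 , p , eq) β@(t , b′ , t∈ , t≉0 , q , eq′) =
      s * t , (s * (b′ * x^ m) + a′ * b) , *∈ s∈ t∈ , *-≉0 s≉0 t≉0 ,
      Poly-+ (Poly-scale s∈ (Poly-*x^ m q)) (Poly-* p (Degree⇒Poly β)) , (begin
        (s * t) * x^ (m ℕ.+ n) + (s * (b′ * x^ m) + a′ * b)
          ≈⟨ +-congʳ (*-congˡ (x^-+ m n)) ⟩
        (s * t) * (x^ m * x^ n) + (s * (b′ * x^ m) + a′ * b)
          ≈⟨ solve 7 (λ s t y z b′ a′ b → (s :* t) :* (y :* z) :+ (s :* (b′ :* y) :+ a′ :* b)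
                       := s :* y :* (t :* z :+ b′) :+ a′ :* b) refl s t (x^ m) (x^ n) b′ a′ b ⟩
        s * x^ m * (t * x^ n + b′) + a′ * b  ≈⟨ +-congʳ (*-congˡ eq′) ⟩
        s * x^ m * b + a′ * b                ≈⟨ distribʳ b _ a′ ⟨
        (s * x^ m + a′) * b                  ≈⟨ *-congʳ eq ⟩
        a * b                                ∎)

    -- Gauss's lemma for primes among the constants

    const-∣′ : ∀ {r c b} → S r → S c → S′ b → r ∣′ c + x * b → r ∣ c × r ∣′ b
    const-∣′ {r} {c} {b} r∈ c∈ b∈ (e , e∈ , re≈c+xb) with polynomial e∈
    ... | zero , pzero e≈0 with transcendental c∈ b∈ (trans (sym re≈c+xb) (trans (*-congˡ e≈0) (zeroʳ r)))
    ...   | c≈0 , b≈0 = (0# , 0∈ , trans (zeroʳ r) (sym c≈0)) , (0# , 0∈′ , trans (zeroʳ r) (sym b≈0))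
    const-∣′ {r} {c} {b} r∈ c∈ b∈ (e , e∈ , re≈c+xb) | suc n , psuc {c = e₀} {b = e₁} e₀∈ q eq =
      (e₀ , e₀∈ , x∙y⁻¹≈ε⇒x≈y _ c (proj₁ both)) , (e₁ , Poly⇒S′ q , x∙y⁻¹≈ε⇒x≈y _ b (proj₂ both))
      where
      -- The Horner coefficients of `r * e` and `c + x * b` are compared by applying transcendence
      -- to their difference.
      both : (r * e₀ - c ≈ 0#) × (r * e₁ - b ≈ 0#)
      both = transcendental (+∈ (*∈ r∈ e₀∈) (-∈ c∈)) (+∈′ (*∈′ (S⊆S′ r∈) (Poly⇒S′ q)) (-∈′ b∈)) (begin
        (r * e₀ - c) + x * (r * e₁ - b)
          ≈⟨ solve 6 (λ r e₀ c x e₁ b → (r :* e₀ :+ c) :+ x :* (r :* e₁ :+ b) := r :* (e₀ :+ x :* e₁) :+ (c :+ x :* b)) refl r e₀ (- c) x e₁ (- b) ⟩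
        r * (e₀ + x * e₁) + (- c + x * - b)   ≈⟨ +-congʳ (trans (*-congˡ eq) re≈c+xb) ⟩
        (c + x * b) + (- c + x * - b)         ≈⟨ solve 5 (λ c x b c′ b′ → (c :+ x :* b) :+ (c′ :+ x :* b′) := (c :+ c′) :+ x :* (b :+ b′)) refl c x b (- c) (- b) ⟩
        (c - c) + x * (b - b)                 ≈⟨ +-cong (-‿inverseʳ c) (trans (*-congˡ (-‿inverseʳ b)) (zeroʳ x)) ⟩
        0# + 0#                               ≈⟨ +-identityˡ 0# ⟩
        0#                                    ∎)

    ∣′⇒∣ : ∀ {r c} → S r → S c → r ∣′ c → r ∣ c
    ∣′⇒∣ {r} {c} r∈ c∈ r∣c = proj₁ (const-∣′ r∈ c∈ 0∈′ (∣′-resp r∣c (sym (trans (+-congˡ (zeroʳ x)) (+-identityʳ c)))))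

    ∣′-+ : ∀ {r a b} → r ∣′ a → r ∣′ b → r ∣′ a + b
    ∣′-+ (d , d∈ , eq) (e , e∈ , eq′) = d + e , +∈′ d∈ e∈ , trans (distribˡ _ d e) (+-cong eq eq′)

    ∣′-cancel-+ : ∀ {r a b} → r ∣′ a → r ∣′ a + b → r ∣′ b
    ∣′-cancel-+ {r} {a} {b} (d , d∈ , eq) r∣a+b = ∣′-resp (∣′-+ r∣a+b (- d , -∈′ d∈ , trans (sym (-‿distribʳ-* r d)) (-‿cong eq))) (begin
      (a + b) - a     ≈⟨ solve 3 (λ a b m → (a :+ b) :+ m := (a :+ m) :+ b) refl a b (- a) ⟩
      (a - a) + b     ≈⟨ +-congʳ (-‿inverseʳ a) ⟩
      0# + b          ≈⟨ +-identityˡ b ⟩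
      b               ∎)

    ≈⇒∣′ : ∀ {a b} → a ≈ b → a ∣′ b
    ≈⇒∣′ a≈b = 1# , 1∈′ , trans (*-identityʳ _) a≈b

    x*-∣′ : ∀ {r b} → S r → S′ b → r ∣′ x * b → r ∣′ b
    x*-∣′ r∈ b∈ r∣xb = proj₂ (const-∣′ r∈ 0∈ b∈ (∣′-resp r∣xb (sym (+-identityˡ _))))

    -- Instead of locating the first coefficients not divisible by `π`, the recursion drops a
    -- constant coefficient that `π` divides, passing to the tail of `a` or `b`. If `π` divides
    -- neither constant coefficient, it would still divide their product `c * d`, the constant
    -- coefficient of `a * b`, against primality.
    prime-splits : ∀ {π n m a b} → IsPrime π → Poly n a → Poly m b → π ∣′ a * b → ¬ ¬ (π ∣′ a ⊎ π ∣′ b)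
    prime-splits prime (pzero a≈0) _ _ = return (inj₁ (0# , 0∈′ , trans (zeroʳ _) (sym a≈0)))
    prime-splits prime (psuc _ _ _) (pzero b≈0) _ = return (inj₂ (0# , 0∈′ , trans (zeroʳ _) (sym b≈0)))
    prime-splits {π} {a = a} {b} prime α@(psuc {c = c} {b = a′} c∈ p eq) β@(psuc {c = d} {b = b′} d∈ q eq′) π∣ab = do
      yes π∣c ← ¬¬-excluded-middle {A = π ∣ c}
        where
        no π∤c → do
          yes π∣d ← ¬¬-excluded-middle {A = π ∣ d}
            where
            no π∤d → do
              inj₁ π∣c ← split c∈ d∈ (proj₁ (const-∣′ ∈S (*∈ c∈ d∈)
                  (+∈′ (*∈′ (S⊆S′ c∈) b′∈) (*∈′ a′∈ (Poly⇒S′ β))) (∣′-resp π∣ab (expand eq eq′))))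
                where inj₂ π∣d → ⊥-elim (π∤d π∣d)
              ⊥-elim (π∤c π∣c)
          inj₁ π∣a ← prime-splits prime α q (∣′-resp (tail∣ (Poly⇒S′ α) d∈ b′∈ eq′ π∣d (∣′-resp π∣ab (*-comm a b))) (*-comm b′ a))
            where inj₂ π∣b′ → return (inj₂ (rebuild d∈ b′∈ eq′ π∣d π∣b′))
          return (inj₁ π∣a)
      inj₁ π∣a′ ← prime-splits prime p β (tail∣ (Poly⇒S′ β) c∈ a′∈ eq π∣c π∣ab)
        where inj₂ π∣b → return (inj₂ π∣b)
      return (inj₁ (rebuild c∈ a′∈ eq π∣c π∣a′))
      where
      open IsPrime prime
      a′∈ : S′ a′
      a′∈ = Poly⇒S′ p
      b′∈ : S′ b′
      b′∈ = Poly⇒S′ q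
      expand : ∀ {a b} → c + x * a′ ≈ a → d + x * b′ ≈ b → a * b ≈ c * d + x * (c * b′ + a′ * b)
      expand {a} {b} eq eq′ = begin
        a * b                                           ≈⟨ *-cong eq refl ⟨
        (c + x * a′) * b                                ≈⟨ distribʳ b c _ ⟩
        c * b + x * a′ * b                              ≈⟨ +-congʳ (*-congˡ eq′) ⟨
        c * (d + x * b′) + x * a′ * b
          ≈⟨ solve 6 (λ c d x b′ a′ b → c :* (d :+ x :* b′) :+ x :* a′ :* b := c :* d :+ x :* (c :* b′ :+ a′ :* b)) refl c d x b′ a′ b ⟩
        c * d + x * (c * b′ + a′ * b)                   ∎
      rebuild : ∀ {a c a′} → S c → S′ a′ → c + x * a′ ≈ a → π ∣ c → π ∣′ a′ → π ∣′ a
      rebuild c∈ a′∈ eq π∣c π∣a′ = ∣′-resp (∣′-+ (∣⇒∣′ π∣c) (∣′-*ˡ x∈S′ π∣a′)) eq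
      tail∣ : ∀ {a b c a′} → S′ b → S c → S′ a′ → c + x * a′ ≈ a → π ∣ c → π ∣′ a * b → π ∣′ a′ * b
      tail∣ {a} {b} {c} {a′} b∈ c∈ a′∈ eq π∣c π∣ab = x*-∣′ ∈S (*∈′ a′∈ b∈) (∣′-cancel-+ (∣′-*ʳ b∈ (∣⇒∣′ π∣c)) (∣′-resp π∣ab
        (trans (*-congʳ (sym eq)) (solve 4 (λ c x a b → (c :+ x :* a) :* b := c :* b :+ x :* (a :* b)) refl c x a′ b))))

    prime⇒prime′ : ∀ {π} → IsPrime π → IsPrime′ π
    prime⇒prime′ prime = record
      { ∈S      = S⊆S′ ∈S
      ; ≉0      = ≉0
      ; nonunit = λ π∣1 → nonunit (∣′⇒∣ ∈S 1∈ π∣1)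
      ; split   = λ a∈ b∈ → prime-splits prime (proj₂ (polynomial a∈)) (proj₂ (polynomial b∈))
      }
      where open IsPrime prime

    factorisation⇒factorisation′ : ∀ {a} → Factorisation a → Factorisation′ a
    factorisation⇒factorisation′ (unit a∣1) = unit′ (∣⇒∣′ a∣1)
    factorisation⇒factorisation′ (cons p b∈ φ eq) =
      cons′ (prime⇒prime′ p) (S⊆S′ b∈) (factorisation⇒factorisation′ φ) eq

    -- Primitive polynomials and contents

    Primitive : Carrier → Set _
    Primitive g = ∀ r → S r → r ∣′ g → ¬ ¬ r ∣ 1#

    primitive-∣ : ∀ {g y} → Primitive g → y ∣′ g → Primitive y
    primitive-∣ prim y∣g r r∈ r∣y = prim r r∈ (∣′-trans r∣y y∣g)

    -- The induction strips primes off a bound a for the constants dividing f; a prime of a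
    -- not dividing f can be dropped from the bound.
    content : ∀ {a f} → Factorisation a → S′ f → (∀ {r} → S r → r ∣′ f → ¬ ¬ r ∣ a) →
              ¬ ¬ ∃₂ λ c g → S c × Factorisation c × S′ g × (c * g ≈ f) × Primitive g
    content {f = f} (unit a∣1) f∈ h = return (1# , f , 1∈ , unit (1# , 1∈ , *-identityˡ 1#) , f∈ , *-identityˡ f ,
      λ _ r∈ r∣f → h r∈ r∣f >>= λ r∣a → return (∣-trans r∣a a∣1))
    content {a} {f} (cons {π} {b} prime b∈ φ πb≈a) f∈ h = do
      yes (f₁ , f₁∈ , πf₁≈f) ← ¬¬-excluded-middle {A = π ∣′ f}
        where no π∤f → content φ f∈ λ {r} r∈ r∣f → do
                (t , t∈ , rt≈a) ← h r∈ r∣f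
                inj₂ (t′ , t′∈ , πt′≈t) ← split r∈ t∈ (b , b∈ , trans πb≈a (sym rt≈a))
                  where inj₁ π∣r → ⊥-elim (π∤f (∣′-trans (∣⇒∣′ π∣r) r∣f))
                return (t′ , t′∈ , *-cancelˡ ≉0 (begin
                  π * (r * t′)   ≈⟨ solve 3 (λ p r t → p :* (r :* t) := r :* (p :* t)) refl π r t′ ⟩
                  r * (π * t′)   ≈⟨ *-congˡ πt′≈t ⟩
                  r * t          ≈⟨ rt≈a ⟩
                  a              ≈⟨ πb≈a ⟨
                  π * b          ∎))
      (c , g , c∈ , ψ , g∈ , cg≈f₁ , prim) ← content φ f₁∈ λ {r} r∈ (t , t∈ , rt≈f₁) → do
        πr∣a ← h (*∈ ∈S r∈) (t , t∈ , trans (*-assoc π r t) (trans (*-congˡ rt≈f₁) πf₁≈f))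
        return (∣-cancelˡ ≉0 (∣-resp πr∣a (sym πb≈a)))
      return (π * c , g , *∈ ∈S c∈ , cons prime c∈ ψ refl , g∈ ,
        trans (*-assoc π c g) (trans (*-congˡ cg≈f₁) πf₁≈f) , prim)
      where open IsPrime prime

    -- A prime `π` of `c` divides `g * k`, where `k` is the cofactor. It cannot divide the primitive
    -- `g`, so it divides `k` and cancels from both sides; this removes the primes of `c` one at a
    -- time.
    primitive-cancel : ∀ {c g y} → Factorisation c → Primitive g → S′ g → S′ y → g ∣′ c * y → ¬ ¬ g ∣′ y
    primitive-cancel {c} {y = y} (unit (u , u∈ , cu≈1)) prim g∈ y∈ g∣cy = return (∣′-resp (∣′-*ˡ (S⊆S′ u∈) g∣cy) (begin
      u * (c * y)   ≈⟨ solve 3 (λ u c y → u :* (c :* y) := (c :* u) :* y) refl u c y ⟩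
      (c * u) * y   ≈⟨ *-congʳ cu≈1 ⟩
      1# * y        ≈⟨ *-identityˡ y ⟩
      y             ∎))
    primitive-cancel {c} {g} {y} (cons {π} {b} prime b∈ φ πb≈c) prim g∈ y∈ (k , k∈ , gk≈cy) = do
      inj₂ (k′ , k′∈ , πk′≈k) ← IsPrime′.split (prime⇒prime′ prime) g∈ k∈ (b * y , *∈′ (S⊆S′ b∈) y∈ , πby≈gk)
        where inj₁ π∣g → prim π ∈S π∣g >>= λ π∣1 → ⊥-elim (nonunit π∣1)
      primitive-cancel φ prim g∈ y∈ (k′ , k′∈ , *-cancelˡ ≉0 (begin
        π * (g * k′)   ≈⟨ solve 3 (λ p r t → p :* (r :* t) := r :* (p :* t)) refl π g k′ ⟩
        g * (π * k′)   ≈⟨ *-congˡ πk′≈k ⟩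
        g * k          ≈⟨ πby≈gk ⟨
        π * (b * y)    ∎))
      where
      open IsPrime prime
      open Divisibility T S′ using () renaming (module IsPrime to IsPrime′)
      πby≈gk : π * (b * y) ≈ g * k
      πby≈gk = trans (sym (*-assoc π b y)) (trans (*-congʳ πb≈c) (sym gk≈cy))

    -- By Gauss's lemma each prime of `c` divides `d` or `e`. Those taken from `d` are collected in
    -- `c′`, those taken from `e` are cancelled, and what remains of `d` divides `g`. This replaces
    -- dividing by a constant in the field of fractions.
    split-off-constant : ∀ {c g d e} → Factorisation c → S′ g → S′ d → S′ e → c * g ≈ d * e →
                         ¬ ¬ ∃₂ λ c′ d′ → S c′ × S′ d′ × d′ ∣′ g × (c′ * d′ ≈ d)
    split-off-constant {c} {g} {d} {e} (unit (u , u∈ , cu≈1)) g∈ d∈ e∈ cg≈de =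
      return (1# , d , 1∈ , d∈ , (e * u , *∈′ e∈ (S⊆S′ u∈) , (begin
        d * (e * u)   ≈⟨ *-assoc d e u ⟨
        d * e * u     ≈⟨ *-congʳ cg≈de ⟨
        c * g * u     ≈⟨ solve 3 (λ c g u → c :* g :* u := (c :* u) :* g) refl c g u ⟩
        (c * u) * g   ≈⟨ *-congʳ cu≈1 ⟩
        1# * g        ≈⟨ *-identityˡ g ⟩
        g             ∎)) , *-identityˡ d)
    split-off-constant {c} {g} {d} {e} (cons {π} {b} prime b∈ φ πb≈c) g∈ d∈ e∈ cg≈de = do
      inj₁ (d₁ , d₁∈ , πd₁≈d) ← prime-splits prime (proj₂ (polynomial d∈)) (proj₂ (polynomial e∈))
          (b * g , *∈′ (S⊆S′ b∈) g∈ , πbg≈de)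
        where inj₂ (e₁ , e₁∈ , πe₁≈e) → split-off-constant φ g∈ d∈ e₁∈ (*-cancelˡ ≉0 (begin
                π * (b * g)    ≈⟨ πbg≈de ⟩
                d * e          ≈⟨ *-congˡ πe₁≈e ⟨
                d * (π * e₁)   ≈⟨ solve 3 (λ p r t → r :* (p :* t) := p :* (r :* t)) refl π d e₁ ⟩
                π * (d * e₁)   ∎))
      (c′ , d′ , c′∈ , d′∈ , d′∣g , c′d′≈d₁) ← split-off-constant φ g∈ d₁∈ e∈ (*-cancelˡ ≉0 (begin
        π * (b * g)    ≈⟨ πbg≈de ⟩
        d * e          ≈⟨ *-congʳ πd₁≈d ⟨
        π * d₁ * e     ≈⟨ *-assoc π d₁ e ⟩
        π * (d₁ * e)   ∎))
      return (π * c′ , d′ , *∈ ∈S c′∈ , d′∈ , d′∣g , trans (*-assoc π c′ d′) (trans (*-congˡ c′d′≈d₁) πd₁≈d))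
      where
      open IsPrime prime
      πbg≈de : π * (b * g) ≈ d * e
      πbg≈de = trans (sym (*-assoc π b g)) (trans (*-congʳ πb≈c) cg≈de)

    -- Pseudo-division in the ideal generated by two elements

    module Ideal (g a : Carrier) (g∈ : S′ g) (a∈ : S′ a) where

      infix 4 _∈I
      _∈I : Carrier → Set _
      u ∈I = ∃₂ λ v w → S′ v × S′ w × (g * v + a * w ≈ u)

      ∈I⇒S′ : ∀ {u} → u ∈I → S′ u
      ∈I⇒S′ (v , w , v∈ , w∈ , eq) = resp′ eq (+∈′ (*∈′ g∈ v∈) (*∈′ a∈ w∈))

      g∈I : g ∈I
      g∈I = 1# , 0# , 1∈′ , 0∈′ , trans (+-cong (*-identityʳ g) (zeroʳ a)) (+-identityʳ g)

      a∈I : a ∈I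
      a∈I = 0# , 1# , 0∈′ , 1∈′ , trans (+-cong (zeroʳ g) (*-identityʳ a)) (+-identityˡ a)

      combine : ∀ {r s u v} → S′ r → S′ s → u ∈I → v ∈I → r * u + s * v ∈I
      combine {r} {s} {u} {v} r∈ s∈ (p , q , p∈ , q∈ , eq) (p′ , q′ , p′∈ , q′∈ , eq′) =
        r * p + s * p′ , r * q + s * q′ , +∈′ (*∈′ r∈ p∈) (*∈′ s∈ p′∈) , +∈′ (*∈′ r∈ q∈) (*∈′ s∈ q′∈) , (begin
          g * (r * p + s * p′) + a * (r * q + s * q′)
            ≈⟨ solve 8 (λ g a r s p p′ q q′ → g :* (r :* p :+ s :* p′) :+ a :* (r :* q :+ s :* q′)
                 := r :* (g :* p :+ a :* q) :+ s :* (g :* p′ :+ a :* q′)) refl g a r s p p′ q q′ ⟩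
          r * (g * p + a * q) + s * (g * p′ + a * q′)   ≈⟨ +-cong (*-congˡ eq) (*-congˡ eq′) ⟩
          r * u + s * v   ∎)

      -- Over the field of fractions of `S`, such a `d` generates the ideal, hence is a gcd of `g`
      -- and `a`; `multiple` expresses this with denominators cleared.
      Minimal : ℕ → Carrier → Set _
      Minimal n d = d ∈I × Degree n d × (∀ e → e ∈I → Poly n e → ¬ ¬ e ≈ 0#)

      minimal : ∀ n {d} → Poly n d → ¬ d ≈ 0# → d ∈I → ¬ ¬ ∃₂ Minimal
      minimal zero (pzero d≈0) d≉0 _ = ⊥-elim (d≉0 d≈0)
      minimal (suc n) p d≉0 d∈I = do
        no none ← ¬¬-excluded-middle {A = ∃ λ e → e ∈I × Poly n e × ¬ e ≈ 0#}
          where yes (e , e∈I , q , e≉0) → minimal n q e≉0 e∈I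
        (m , deg) ← Poly⇒Degree p d≉0
        -- The degree is at most `n` by the bound `p`; if it were smaller, `d` itself would be one
        -- of the elements excluded by `none`.
        yes m≡n ← return (m ℕ.≟ n)
          where no m≢n → ⊥-elim (none (_ , d∈I ,
                  Poly-mono (ℕ.≤∧≢⇒< (ℕ.≮⇒≥ λ n<m → Degree⇒≰ deg (Poly-mono n<m p)) m≢n) (Degree⇒Poly deg) , d≉0))
        return (n , _ , d∈I , ≡.subst (λ k → Degree k _) m≡n deg , λ e e∈I q e≉0 → none (e , e∈I , q , e≉0))

      -- Multiplying `u` by the leading coefficient `t` of `d` lets its top term be cancelled by a
      -- multiple of `d` without leaving the ideal. After `j` rounds the remainder has degree below
      -- `n` and vanishes by minimality; the multiplier `c` is built from factors `t`, hence is
      -- nonzero.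
      pseudo-multiple : ∀ {n d} → Minimal n d → ∀ j {u} → u ∈I → Poly (j ℕ.+ n) u →
                        ¬ ¬ ∃₂ λ c e → S c × (¬ c ≈ 0#) × S′ e × (c * u ≈ d * e)
      pseudo-multiple {d = d} (_ , _ , least) zero {u} u∈I p = do
        u≈0 ← least u u∈I p
        return (1# , 0# , 1∈ , 1≉0 , 0∈′ , trans (*-identityˡ u) (trans u≈0 (sym (zeroʳ d))))
      pseudo-multiple {n} {d} μ@(d∈I , (t , d′ , t∈ , t≉0 , q , eq′) , _) (suc j) {u} u∈I p with Poly-leading p
      ... | s , u′ , s∈ , p′ , eq = do
        (c , e , c∈ , c≉0 , e∈ , cw≈de) ← pseudo-multiple μ j (combine (S⊆S′ t∈) m∈ u∈I d∈I) w-poly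
        return (c * t , e + c * m̅ , *∈ c∈ t∈ , *-≉0 c≉0 t≉0 , +∈′ e∈ (*∈′ (S⊆S′ c∈) m̅∈) , (begin
          c * t * u                           ≈⟨ +-identityʳ _ ⟨
          c * t * u + 0#                      ≈⟨ +-congˡ (trans (*-congˡ (-‿inverseˡ m̅)) (zeroʳ (c * d))) ⟨
          c * t * u + c * d * (- m̅ + m̅)
            ≈⟨ solve 6 (λ c t u d m m̅ → c :* t :* u :+ c :* d :* (m :+ m̅) := c :* (t :* u :+ m :* d) :+ d :* (c :* m̅)) refl c t u d (- m̅) m̅ ⟩
          c * (t * u + - m̅ * d) + d * (c * m̅)  ≈⟨ +-congʳ cw≈de ⟩
          d * e + d * (c * m̅)                  ≈⟨ distribˡ d e _ ⟨
          d * (e + c * m̅)                      ∎))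
        where
        m̅ : Carrier
        m̅ = s * x^ j
        m̅∈ : S′ m̅
        m̅∈ = *∈′ (S⊆S′ s∈) (x^∈S′ j)
        m∈ : S′ (- m̅)
        m∈ = -∈′ m̅∈
        w-poly : Poly (j ℕ.+ n) (t * u + - m̅ * d)
        -- The terms of degree `j + n` in `t * u` and `m̅ * d` are both `t * s * x^ (j + n)`, so
        -- only the combination of the lower parts `u′` and `d′` survives.
        w-poly = Poly-resp (begin
          t * u′ + (- s) * (d′ * x^ j)
            ≈⟨ +-congˡ (solve 3 (λ s d y → s :* (d :* y) := (s :* y) :* d) refl (- s) d′ (x^ j)) ⟩
          t * u′ + (- s * x^ j) * d′                          ≈⟨ +-congˡ (*-congʳ (-‿distribˡ-* s (x^ j))) ⟨
          t * u′ + - m̅ * d′                                    ≈⟨ +-identityˡ _ ⟨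
          0# + (t * u′ + - m̅ * d′)                             ≈⟨ +-congʳ (trans (*-congˡ (-‿inverseʳ m̅)) (zeroʳ (t * x^ n))) ⟨
          t * x^ n * (m̅ - m̅) + (t * u′ + - m̅ * d′)
            ≈⟨ solve 7 (λ t y z s m u′ d′ → t :* z :* (s :* y :+ m) :+ (t :* u′ :+ m :* d′)
                 := t :* (s :* (y :* z) :+ u′) :+ m :* (t :* z :+ d′)) refl t (x^ j) (x^ n) s (- m̅) u′ d′ ⟩
          t * (s * (x^ j * x^ n) + u′) + - m̅ * (t * x^ n + d′)
            ≈⟨ +-cong (*-congˡ (trans (+-congʳ (*-congˡ (sym (x^-+ j n)))) eq)) (*-congˡ eq′) ⟩
          t * u + - m̅ * d                                      ∎)
          (Poly-+ (Poly-scale t∈ p′) (Poly-scale (-∈ s∈) (Poly-*x^ j q)))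

      multiple : ∀ {n d u} → Minimal n d → u ∈I → ¬ ¬ ∃₂ λ c e → S c × (¬ c ≈ 0#) × S′ e × (c * u ≈ d * e)
      multiple {n} μ u∈I with polynomial (∈I⇒S′ u∈I)
      ... | k , p = pseudo-multiple μ k u∈I (Poly-mono (ℕ.m≤m+n k n) p)

    -- Prime factorisations in the extension

    module _ (primeFactorial : PrimeFactorial) where

      -- If g ∣ a b, let d be of minimal degree in the ideal (g , a).  Pseudo-division gives
      -- c g = d e with c constant, so g = d′ e′ with d = c′ d′ and c′ constant.  If d′ is a
      -- unit, then g ∣ d b forces g ∣ b; otherwise e′ is a unit, so g ∣ d, and c₂ a = d e₂
      -- forces g ∣ a.
      irreducible⇒prime : ∀ {g} → S′ g → ¬ g ≈ 0# → ¬ g ∣′ 1# → Primitive g →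
        (∀ {y z} → S′ y → S′ z → y * z ≈ g → ¬ y ∣′ 1# → ¬ ¬ z ∣′ 1#) → IsPrime′ g
      irreducible⇒prime {g} g∈ g≉0 g∤1 prim irred = record { ∈S = g∈ ; ≉0 = g≉0 ; nonunit = g∤1 ; split = splits }
        where
        splits : ∀ {a b} → S′ a → S′ b → g ∣′ a * b → ¬ ¬ (g ∣′ a ⊎ g ∣′ b)
        splits {a} {b} a∈ b∈ g∣ab = do
          (n , d , μ@(d∈I@(v , w , v∈ , w∈ , gv+aw≈d) , _)) ← minimal _ (proj₂ (polynomial g∈)) g≉0 g∈I
          (c , e , c∈ , c≉0 , e∈ , cg≈de) ← multiple μ g∈I
          φ ← primeFactorial c c∈ c≉0
          (c′ , d′ , c′∈ , d′∈ , (e′ , e′∈ , d′e′≈g) , c′d′≈d) ← split-off-constant φ g∈ (∈I⇒S′ d∈I) e∈ cg≈de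
          no d′∤1 ← ¬¬-excluded-middle {A = d′ ∣′ 1#}
            where
            yes (d⁻¹ , d⁻¹∈ , d′d⁻¹≈1) → do
              ψ ← primeFactorial c′ c′∈ (λ c′≈0 →
                    *-≉0ˡ (λ de≈0 → *-≉0 c≉0 g≉0 (trans cg≈de de≈0)) (trans (sym c′d′≈d) (trans (*-congʳ c′≈0) (zeroˡ d′))))
              g∣d′b ← primitive-cancel ψ prim g∈ (*∈′ d′∈ b∈) (∣′-resp
                (∣′-+ (∣′-*ʳ (*∈′ v∈ b∈) (≈⇒∣′ refl)) (∣′-*ˡ w∈ g∣ab)) (begin
                  g * (v * b) + w * (a * b)
                    ≈⟨ solve 5 (λ g v b w a → g :* (v :* b) :+ w :* (a :* b) := (g :* v :+ a :* w) :* b) refl g v b w a ⟩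
                  (g * v + a * w) * b   ≈⟨ *-congʳ (trans gv+aw≈d (sym c′d′≈d)) ⟩
                  c′ * d′ * b           ≈⟨ *-assoc c′ d′ b ⟩
                  c′ * (d′ * b)         ∎))
              return (inj₂ (∣′-resp (∣′-*ˡ d⁻¹∈ g∣d′b) (begin
                d⁻¹ * (d′ * b)   ≈⟨ solve 3 (λ u d b → u :* (d :* b) := (d :* u) :* b) refl d⁻¹ d′ b ⟩
                (d′ * d⁻¹) * b   ≈⟨ *-congʳ d′d⁻¹≈1 ⟩
                1# * b           ≈⟨ *-identityˡ b ⟩
                b                ∎)))
          (e⁻¹ , e⁻¹∈ , e′e⁻¹≈1) ← irred d′∈ e′∈ d′e′≈g d′∤1
          (c₂ , e₂ , c₂∈ , c₂≉0 , e₂∈ , c₂a≈de₂) ← multiple μ a∈I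
          φ₂ ← primeFactorial c₂ c₂∈ c₂≉0
          g∣a ← primitive-cancel φ₂ prim g∈ a∈ (e⁻¹ * (c′ * e₂) , *∈′ e⁻¹∈ (*∈′ (S⊆S′ c′∈) e₂∈) , (begin
            g * (e⁻¹ * (c′ * e₂))           ≈⟨ *-congʳ d′e′≈g ⟨
            d′ * e′ * (e⁻¹ * (c′ * e₂))
              ≈⟨ solve 5 (λ d e u c e₂ → d :* e :* (u :* (c :* e₂)) := (e :* u) :* (c :* d :* e₂)) refl d′ e′ e⁻¹ c′ e₂ ⟩
            (e′ * e⁻¹) * (c′ * d′ * e₂)     ≈⟨ *-cong e′e⁻¹≈1 (*-congʳ c′d′≈d) ⟩
            1# * (d * e₂)                   ≈⟨ *-identityˡ _ ⟩
            d * e₂                          ≈⟨ c₂a≈de₂ ⟨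
            c₂ * a                          ∎))
          return (inj₁ g∣a)
          where open Ideal g a g∈ a∈

      -- Factors of a primitive element are primitive, so a factor of degree 0 is a unit. In a
      -- factorisation into two nonunits both degrees are therefore positive, each is smaller than
      -- their sum, and the recursion can run on the degree bound.
      primitive-factorisation : ∀ n {g} → Poly n g → ¬ g ≈ 0# → Primitive g → ¬ ¬ Factorisation′ g
      primitive-factorisation zero (pzero g≈0) g≉0 _ = ⊥-elim (g≉0 g≈0)
      primitive-factorisation (suc n) {g} p g≉0 prim = do
        no g∤1 ← ¬¬-excluded-middle {A = g ∣′ 1#}
          where yes g∣1 → return (unit′ g∣1)
        yes (y , z , y∈ , z∈ , yz≈g , y∤1 , z∤1) ← ¬¬-excluded-middle
            {A = ∃₂ λ y z → S′ y × S′ z × (y * z ≈ g) × (¬ y ∣′ 1#) × (¬ z ∣′ 1#)}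
          where no irred → return (cons′ (irreducible⇒prime g∈ g≉0 g∤1 prim
                  λ {y} {z} y∈ z∈ yz≈g y∤1 z∤1 → irred (_ , _ , y∈ , z∈ , yz≈g , y∤1 , z∤1))
                  1∈′ (unit′ (1# , 1∈′ , *-identityˡ 1#)) (*-identityʳ g))
        let y≉0 = λ y≈0 → g≉0 (trans (sym yz≈g) (trans (*-congʳ y≈0) (zeroˡ z)))
        let z≉0 = λ z≈0 → g≉0 (trans (sym yz≈g) (trans (*-congˡ z≈0) (zeroʳ y)))
        let prim-y = primitive-∣ prim (z , z∈ , yz≈g)
        let prim-z = primitive-∣ prim (y , y∈ , trans (*-comm z y) yz≈g)
        (k , deg-y) ← Poly⇒Degree (proj₂ (polynomial y∈)) y≉0
        (l , deg-z) ← Poly⇒Degree (proj₂ (polynomial z∈)) z≉0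
        1≤k ← nonconstant deg-y prim-y y∤1
        1≤l ← nonconstant deg-z prim-z z∤1
        let k+l≤n = ℕ.≮⇒≥ λ n<k+l → Degree⇒≰ (Degree-* deg-y deg-z) (Poly-mono n<k+l (Poly-resp (sym yz≈g) p))
        φ ← primitive-factorisation n (Poly-mono (ℕ.≤-trans (≡.subst (ℕ._≤ k ℕ.+ l) (ℕ.+-comm k 1) (ℕ.+-monoʳ-≤ k 1≤l)) k+l≤n)
              (Degree⇒Poly deg-y)) y≉0 prim-y
        ψ ← primitive-factorisation n (Poly-mono (ℕ.≤-trans (ℕ.+-monoˡ-≤ l 1≤k) k+l≤n) (Degree⇒Poly deg-z)) z≉0 prim-z
        return (factorisation-resp′ yz≈g (*-factorisation′ y∈ z∈ φ ψ))
        where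
        g∈ : S′ g
        g∈ = Poly⇒S′ p
        nonconstant : ∀ {n y} → Degree n y → Primitive y → ¬ y ∣′ 1# → ¬ ¬ 1 ℕ.≤ n
        nonconstant {suc n} _ _ _ = return (s≤s z≤n)
        nonconstant {zero} {y} (s , y′ , s∈ , _ , pzero y′≈0 , eq) prim-y y∤1 =
          prim-y s s∈ (≈⇒∣′ s≈y) >>= λ s∣1 → ⊥-elim (y∤1 (∣′-trans (≈⇒∣′ (sym s≈y)) (∣⇒∣′ s∣1)))
          where
          s≈y : s ≈ y
          s≈y = trans (sym (trans (+-cong (*-identityʳ s) y′≈0) (+-identityʳ s))) eq

      primeFactorial-extension : PrimeFactorial′
      primeFactorial-extension f f∈ f≉0 = do
        (n , s , f′ , s∈ , s≉0 , p , eq) ← Poly⇒Degree (proj₂ (polynomial f∈)) f≉0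
        -- Every constant dividing `f` divides its leading coefficient `s`, whose factorisation can
        -- therefore serve as the bound in `content`.
        φ ← primeFactorial s s∈ s≉0
        (c , g , c∈ , χ , g∈ , cg≈f , prim) ← content φ f∈ λ {r} r∈ r∣f → return (leading-∣ n r∈ s∈ p eq r∣f)
        ψ ← primitive-factorisation _ (proj₂ (polynomial g∈)) (λ g≈0 → f≉0 (trans (sym cg≈f) (trans (*-congˡ g≈0) (zeroʳ c)))) prim
        return (factorisation-resp′ cg≈f (*-factorisation′ (S⊆S′ c∈) g∈ (factorisation⇒factorisation′ χ) ψ))
        where
        leading-∣ : ∀ n {r s f f′} → S r → S s → Poly n f′ → s * x^ n + f′ ≈ f → r ∣′ f → r ∣ s
        leading-∣ zero {s = s} r∈ s∈ (pzero f′≈0) eq r∣f =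
          ∣′⇒∣ r∈ s∈ (∣′-resp r∣f (trans (sym eq) (trans (+-cong (*-identityʳ s) f′≈0) (+-identityʳ s))))
        leading-∣ (suc n) {r} {s} {f} r∈ s∈ (psuc {c = c} {b = b} c∈ p eq′) eq r∣f =
          leading-∣ n r∈ s∈ p refl (proj₂ (const-∣′ r∈ c∈ (+∈′ (*∈′ (S⊆S′ s∈) (x^∈S′ n)) (Poly⇒S′ p)) (∣′-resp r∣f (begin
            f                                   ≈⟨ eq ⟨
            s * (x * x^ n) + _                  ≈⟨ +-congˡ eq′ ⟨
            s * (x * x^ n) + (c + x * b)
              ≈⟨ solve 5 (λ s x y c b → s :* (x :* y) :+ (c :+ x :* b) := c :+ x :* (s :* y :+ b)) refl s x (x^ n) c b ⟩
            c + x * (s * x^ n + b)              ∎))))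

-- The ring of Dirichlet polynomials

module DirichletConvolution {c ℓ} (R : CommutativeRing c ℓ) where
  open CommutativeRing R hiding (zero)
  open Theory R
  open RingProperties ring using (-0#≈0#)
  open Sum semiring using (sum; sum-cong-≋; sum-replicate-zero; ∑-comm; ∑-distrib-+; *-distribˡ-sum)
  open SemiringSolver commutativeSemiring using (solve; _:*_; _:=_)
  open SetoidReasoning setoid

  opaque
    ∑ : ℕ → (ℕ → Carrier) → Carrier
    ∑ n f = sum {n} (λ i → f (toℕ i))

  syntax ∑ n (λ i → x) = ∑[ i < n ] x

  opaque
    unfolding ∑

    ∑-suc : ∀ n f → ∑ (suc n) f ≈ f 0 + ∑ n (f ∘ suc)
    ∑-suc n f = refl

    ∑-cong : ∀ n {f g} → (∀ i → i ℕ.< n → f i ≈ g i) → ∑ n f ≈ ∑ n g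
    ∑-cong n f≈g = sum-cong-≋ (λ i → f≈g (toℕ i) (Fin.toℕ<n i))

    ∑-zero : ∀ n {f} → (∀ i → i ℕ.< n → f i ≈ 0#) → ∑ n f ≈ 0#
    ∑-zero n {f} f≈0 = trans (∑-cong n {f} f≈0) (sum-replicate-zero n)

    ∑-+ : ∀ n f g → ∑[ i < n ] (f i + g i) ≈ ∑ n f + ∑ n g
    ∑-+ n f g = ∑-distrib-+ {n} (f ∘ toℕ) (g ∘ toℕ)

    ∑-*ˡ : ∀ n x f → x * ∑ n f ≈ ∑[ i < n ] (x * f i)
    ∑-*ˡ n x f = *-distribˡ-sum {n} x (f ∘ toℕ)

    ∑-swap : ∀ m n (F : ℕ → ℕ → Carrier) → ∑[ i < m ] ∑[ j < n ] F i j ≈ ∑[ j < n ] ∑[ i < m ] F i j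
    ∑-swap m n F = ∑-comm {m} {n} (λ i j → F (toℕ i) (toℕ j))

    sumR-applyUpTo : ∀ f n → sumR (applyUpTo f n) ≈ ∑ n f
    sumR-applyUpTo f zero    = refl
    sumR-applyUpTo f (suc n) = +-congˡ (sumR-applyUpTo (f ∘ suc) n)

  sumR-map-upTo : ∀ f n → sumR (map f (upTo n)) ≈ ∑ n f
  sumR-map-upTo f n = trans (reflexive (≡.cong sumR (map-upTo f n))) (sumR-applyUpTo f n)

  ∑-single : ∀ {n k} f → k ℕ.< n → (∀ i → i ≢ k → f i ≈ 0#) → ∑ n f ≈ f k
  ∑-single {suc n} {zero} f _ f≈0 =
    trans (∑-suc n f) (trans (+-congˡ (∑-zero n (λ i _ → f≈0 (suc i) λ ()))) (+-identityʳ (f 0)))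
  ∑-single {suc n} {suc k} f (s≤s k<n) f≈0 = trans (∑-suc n f) (trans
    (+-cong (f≈0 0 λ ()) (∑-single (f ∘ suc) k<n (λ i i≢k → f≈0 (suc i) (i≢k ∘ ℕ.suc-injective)))) (+-identityˡ _))

  ∑-extend : ∀ {m n} f → m ℕ.≤ n → (∀ i → m ℕ.≤ i → f i ≈ 0#) → ∑ m f ≈ ∑ n f
  ∑-extend {n = n} f z≤n f≈0 = trans (∑-zero 0 λ _ ()) (sym (∑-zero n (λ i _ → f≈0 i z≤n)))
  ∑-extend f (s≤s m≤n) f≈0 = trans (∑-suc _ f)
    (trans (+-congˡ (∑-extend (f ∘ suc) m≤n (λ i m≤i → f≈0 (suc i) (s≤s m≤i)))) (sym (∑-suc _ f)))

  opaque
    -- The Iverson bracket: it turns sums over divisors into sums over rectangles, whose order can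
    -- be interchanged freely.
    [_≡_] : ℕ → ℕ → Carrier
    [ m ≡ n ] = if does (m ℕ.≟ n) then 1# else 0#

    []-≡ : ∀ {m n} x → m ≡ n → [ m ≡ n ] * x ≈ x
    []-≡ {m} {n} x m≡n = go (m ℕ.≟ n)
      where
      go : (d : Dec (m ≡ n)) → (if does d then 1# else 0#) * x ≈ x
      go (yes _)  = *-identityˡ x
      go (no m≢n) = ⊥-elim (m≢n m≡n)

    []-≢ : ∀ {m n} x → m ≢ n → [ m ≡ n ] * x ≈ 0#
    []-≢ {m} {n} x m≢n = go (m ℕ.≟ n)
      where
      go : (d : Dec (m ≡ n)) → (if does d then 1# else 0#) * x ≈ 0#
      go (yes m≡n) = ⊥-elim (m≢n m≡n)
      go (no _)    = zeroˡ x

  []-cong : ∀ {m n} x y → (m ≡ n → x ≈ y) → [ m ≡ n ] * x ≈ [ m ≡ n ] * y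
  []-cong {m} {n} x y x≈y with m ℕ.≟ n
  ... | yes m≡n = *-congˡ (x≈y m≡n)
  ... | no m≢n  = trans ([]-≢ x m≢n) (sym ([]-≢ y m≢n))

  opaque
    -- Starting the sums at the meaningless index 0 is harmless: j * k ≡ i has no such
    -- solution when i ≥ 1.
    conv : ℕ → ℕ → (ℕ → ℕ → Carrier) → Carrier
    conv B i F = ∑[ j < suc B ] ∑[ k < suc B ] ([ j ℕ.* k ≡ i ] * F j k)

    conv-def : ∀ B i F → conv B i F ≈ ∑[ j < suc B ] ∑[ k < suc B ] ([ j ℕ.* k ≡ i ] * F j k)
    conv-def B i F = refl

  opaque
    unfolding conv

    conv-cong : ∀ B {i F G} → (∀ j k → j ℕ.* k ≡ i → F j k ≈ G j k) → conv B i F ≈ conv B i G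
    conv-cong B F≈G = ∑-cong (suc B) λ j _ → ∑-cong (suc B) λ k _ → []-cong _ _ (F≈G j k)

    conv-zero : ∀ B {i F} → (∀ j k → j ℕ.* k ≡ i → F j k ≈ 0#) → conv B i F ≈ 0#
    conv-zero B F≈0 = ∑-zero (suc B) λ j _ → ∑-zero (suc B) λ k _ → trans ([]-cong _ 0# (F≈0 j k)) (zeroʳ _)

    conv-comm : ∀ B i F → conv B i F ≈ conv B i (λ j k → F k j)
    conv-comm B i F = trans (∑-swap (suc B) (suc B) _)
      (∑-cong (suc B) λ j _ → ∑-cong (suc B) λ k _ →
        *-congʳ (reflexive (≡.cong (λ n → [ n ≡ i ]) (ℕ.*-comm k j))))

    conv-+ : ∀ B i F G → conv B i (λ j k → F j k + G j k) ≈ conv B i F + conv B i G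
    conv-+ B i F G = trans
      (∑-cong (suc B) λ j _ → trans (∑-cong (suc B) λ k _ → distribˡ _ _ _) (∑-+ (suc B) _ _))
      (∑-+ (suc B) _ _)

    conv-single : ∀ B {i} F j k → j ℕ.≤ B → k ℕ.≤ B → j ℕ.* k ≡ i →
      (∀ j′ k′ → j′ ℕ.* k′ ≡ i → ¬ (j′ ≡ j × k′ ≡ k) → F j′ k′ ≈ 0#) → conv B i F ≈ F j k
    conv-single B {i} F j k j≤B k≤B jk≡i F≈0 = begin
      conv B i F                                   ≈⟨ ∑-single _ (s≤s j≤B) (λ j′ j′≢j → ∑-zero (suc B) λ k′ _ → vanish (j′≢j ∘ proj₁)) ⟩
      ∑[ k′ < suc B ] ([ j ℕ.* k′ ≡ i ] * F j k′)  ≈⟨ ∑-single _ (s≤s k≤B) (λ k′ k′≢k → vanish (k′≢k ∘ proj₂)) ⟩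
      [ j ℕ.* k ≡ i ] * F j k                      ≈⟨ []-≡ _ jk≡i ⟩
      F j k                                        ∎
      where
      vanish : ∀ {j′ k′} → ¬ (j′ ≡ j × k′ ≡ k) → [ j′ ℕ.* k′ ≡ i ] * F j′ k′ ≈ 0#
      vanish {j′} {k′} ≢ = trans ([]-cong _ 0# (λ eq → F≈0 j′ k′ eq ≢)) (zeroʳ _)

  factorˡ≤ : ∀ j k {i} → 1 ℕ.≤ i → j ℕ.* k ≡ i → j ℕ.≤ i
  factorˡ≤ j zero 1≤i eq rewrite ℕ.*-zeroʳ j = ⊥-elim (ℕ.<⇒≢ 1≤i eq)
  factorˡ≤ j (suc k) 1≤i eq = ≡.subst (j ℕ.≤_) eq (ℕ.m≤m*n j (suc k))

  factorˡ≥1 : ∀ j k {i} → 1 ℕ.≤ i → j ℕ.* k ≡ i → 1 ℕ.≤ j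
  factorˡ≥1 zero k 1≤i eq = ⊥-elim (ℕ.<⇒≢ 1≤i eq)
  factorˡ≥1 (suc j) k 1≤i eq = s≤s z≤n

  factorʳ≥1 : ∀ j k {i} → 1 ℕ.≤ i → j ℕ.* k ≡ i → 1 ℕ.≤ k
  factorʳ≥1 j k 1≤i eq = factorˡ≥1 k j 1≤i (≡.trans (ℕ.*-comm k j) eq)

  -- The bound `B` is left free so that in an iterated product the inner coefficient at `j ≤ i` can
  -- be summed over the same range as the outer one at `i`.
  ⋆≈conv : ∀ a b {i B} → 1 ℕ.≤ i → i ℕ.≤ B → (a ⋆ b) i ≈ conv B i (λ j k → a j * b k)
  ⋆≈conv a b {i} {B} 1≤i i≤B = begin
    (a ⋆ b) i                    ≈⟨ trans (sumR-map-upTo _ i) (∑-cong i (λ k _ → term k)) ⟩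
    -- Enlarging the range is harmless: a divisor of `i` never exceeds `i`, so the added rows
    -- vanish.
    ∑[ j < i ] row (suc j)       ≈⟨ ∑-extend _ i≤B (λ j i≤j → ∑-zero (suc B) λ k _ → []-≢ _ λ eq →
                                      ℕ.<⇒≱ (s≤s i≤j) (factorˡ≤ (suc j) k 1≤i eq)) ⟩
    ∑[ j < B ] row (suc j)       ≈⟨ +-identityˡ _ ⟨
    0# + ∑[ j < B ] row (suc j)  ≈⟨ +-congʳ (∑-zero (suc B) λ k _ → []-≢ {0} _ (ℕ.<⇒≢ 1≤i)) ⟨
    row 0 + ∑[ j < B ] row (suc j)  ≈⟨ ∑-suc B row ⟨
    ∑[ j < suc B ] row j         ≈⟨ conv-def B i _ ⟨
    conv B i (λ j k → a j * b k) ∎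
    where
    row : ℕ → Carrier
    row j = ∑[ k < suc B ] ([ j ℕ.* k ≡ i ] * (a j * b k))
    term : ∀ j → (if does (suc j ∣? i) then a (suc j) * b (i / suc j) else 0#) ≈ row (suc j)
    term j = go (suc j ∣? i)
      where
      go : (d : Dec (suc j ℕ.∣ i)) → (if does d then a (suc j) * b (i / suc j) else 0#) ≈ row (suc j)
      go (no j∤i) = sym (∑-zero (suc B) λ k _ → []-≢ _ λ eq → j∤i (divides k (≡.trans (≡.sym eq) (ℕ.*-comm (suc j) k))))
      go (yes (divides q i≡q*j)) = begin
        a (suc j) * b (i / suc j)
          ≡⟨ ≡.cong (λ n → a (suc j) * b n) (≡.trans (≡.cong (_/ suc j) i≡q*j) (m*n/n≡m q (suc j))) ⟩
        a (suc j) * b q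
          ≈⟨ []-≡ _ j*q≡i ⟨
        [ suc j ℕ.* q ≡ i ] * (a (suc j) * b q)
          ≈⟨ ∑-single _ (s≤s (ℕ.≤-trans (factorˡ≤ q (suc j) 1≤i (≡.sym i≡q*j)) i≤B)) (λ k k≢q → []-≢ _ λ eq →
               k≢q (ℕ.*-cancelˡ-≡ k q (suc j) (≡.trans eq (≡.sym j*q≡i)))) ⟨
        row (suc j) ∎
        where
        j*q≡i : suc j ℕ.* q ≡ i
        j*q≡i = ≡.trans (ℕ.*-comm (suc j) q) (≡.sym i≡q*j)

  ⋆-cong : ∀ {a a′ b b′} → a ≈D a′ → b ≈D b′ → (a ⋆ b) ≈D (a′ ⋆ b′)
  ⋆-cong {a} {a′} {b} {b′} a≈a′ b≈b′ i 1≤i = begin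
    (a ⋆ b) i                           ≈⟨ ⋆≈conv a b 1≤i ℕ.≤-refl ⟩
    conv i i (λ j k → a j * b k)        ≈⟨ conv-cong i (λ j k eq → *-cong (a≈a′ j (factorˡ≥1 j k 1≤i eq)) (b≈b′ k (factorʳ≥1 j k 1≤i eq))) ⟩
    conv i i (λ j k → a′ j * b′ k)      ≈⟨ ⋆≈conv a′ b′ 1≤i ℕ.≤-refl ⟨
    (a′ ⋆ b′) i                         ∎

  ⋆-comm : ∀ a b → (a ⋆ b) ≈D (b ⋆ a)
  ⋆-comm a b i 1≤i = begin
    (a ⋆ b) i                       ≈⟨ ⋆≈conv a b 1≤i ℕ.≤-refl ⟩
    conv i i (λ j k → a j * b k)    ≈⟨ conv-comm i i _ ⟩
    conv i i (λ j k → a k * b j)    ≈⟨ conv-cong i (λ j k _ → *-comm (a k) (b j)) ⟩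
    conv i i (λ j k → b j * a k)    ≈⟨ ⋆≈conv b a 1≤i ℕ.≤-refl ⟨
    (b ⋆ a) i                       ∎

  ⋆-distribˡ : ∀ a b d → (a ⋆ (λ i → b i + d i)) ≈D (λ i → (a ⋆ b) i + (a ⋆ d) i)
  ⋆-distribˡ a b d i 1≤i = begin
    (a ⋆ (λ i → b i + d i)) i                                     ≈⟨ ⋆≈conv a (λ i → b i + d i) 1≤i ℕ.≤-refl ⟩
    conv i i (λ j k → a j * (b k + d k))                          ≈⟨ conv-cong i (λ j k _ → distribˡ (a j) (b k) (d k)) ⟩
    conv i i (λ j k → a j * b k + a j * d k)                      ≈⟨ conv-+ i i _ _ ⟩
    conv i i (λ j k → a j * b k) + conv i i (λ j k → a j * d k)   ≈⟨ +-cong (⋆≈conv a b 1≤i ℕ.≤-refl) (⋆≈conv a d 1≤i ℕ.≤-refl) ⟨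
    (a ⋆ b) i + (a ⋆ d) i                                         ∎

  triple : DSeries → DSeries → DSeries → ℕ → Carrier
  triple a b d i = ∑[ u < suc i ] ∑[ v < suc i ] ∑[ k < suc i ] ([ (u ℕ.* v) ℕ.* k ≡ i ] * (a u * b v * d k))

  -- With this cyclic symmetry and commutativity, associativity requires only one of the two
  -- bracketings to be expanded.
  triple-rotate : ∀ a b d i → triple b d a i ≈ triple a b d i
  triple-rotate a b d i = begin
    triple b d a i
      ≈⟨ ∑-cong I (λ v _ → ∑-swap I I _) ⟩
    (∑[ v < I ] ∑[ u < I ] ∑[ k < I ] ([ (v ℕ.* k) ℕ.* u ≡ i ] * (b v * d k * a u)))
      ≈⟨ ∑-swap I I _ ⟩
    (∑[ u < I ] ∑[ v < I ] ∑[ k < I ] ([ (v ℕ.* k) ℕ.* u ≡ i ] * (b v * d k * a u)))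
      ≈⟨ ∑-cong I (λ u _ → ∑-cong I λ v _ → ∑-cong I λ k _ → *-cong
           (reflexive (≡.cong (λ n → [ n ≡ i ]) (≡.trans (ℕ.*-comm (v ℕ.* k) u) (≡.sym (ℕ.*-assoc u v k)))))
           (solve 3 (λ a b d → b :* d :* a := a :* b :* d) refl (a u) (b v) (d k))) ⟩
    triple a b d i ∎
    where
    I : ℕ
    I = suc i

  [⋆]⋆≈triple : ∀ a b d {i} → 1 ℕ.≤ i → ((a ⋆ b) ⋆ d) i ≈ triple a b d i
  [⋆]⋆≈triple a b d {i} 1≤i = begin
    ((a ⋆ b) ⋆ d) i
      ≈⟨ ⋆≈conv (a ⋆ b) d 1≤i ℕ.≤-refl ⟩
    conv i i (λ j k → (a ⋆ b) j * d k)
      ≈⟨ conv-cong i (λ j k eq → *-congʳ (⋆≈conv a b (factorˡ≥1 j k 1≤i eq) (factorˡ≤ j k 1≤i eq))) ⟩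
    conv i i (λ j k → conv i j (λ u v → a u * b v) * d k)
      ≈⟨ conv-def i i _ ⟩
    (∑[ j < I ] ∑[ k < I ] ([ j ℕ.* k ≡ i ] * (conv i j (λ u v → a u * b v) * d k)))
      ≈⟨ ∑-cong I (λ j _ → ∑-cong I λ k _ → expand j k) ⟩
    (∑[ j < I ] ∑[ k < I ] ∑[ u < I ] ∑[ v < I ] F j k u v)
      -- The interchanges move the sum over `j` to the innermost place, where the bracket
      -- `[ u ℕ.* v ≡ j ]` leaves at most one term.
      ≈⟨ ∑-cong I (λ j _ → ∑-swap I I _) ⟩
    (∑[ j < I ] ∑[ u < I ] ∑[ k < I ] ∑[ v < I ] F j k u v)
      ≈⟨ ∑-swap I I _ ⟩
    (∑[ u < I ] ∑[ j < I ] ∑[ k < I ] ∑[ v < I ] F j k u v)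
      ≈⟨ ∑-cong I (λ u _ → ∑-cong I λ j _ → ∑-swap I I _) ⟩
    (∑[ u < I ] ∑[ j < I ] ∑[ v < I ] ∑[ k < I ] F j k u v)
      ≈⟨ ∑-cong I (λ u _ → ∑-swap I I _) ⟩
    (∑[ u < I ] ∑[ v < I ] ∑[ j < I ] ∑[ k < I ] F j k u v)
      ≈⟨ ∑-cong I (λ u _ → ∑-cong I λ v _ → ∑-swap I I _) ⟩
    (∑[ u < I ] ∑[ v < I ] ∑[ k < I ] ∑[ j < I ] F j k u v)
      ≈⟨ ∑-cong I (λ u _ → ∑-cong I λ v _ → ∑-cong I λ k _ → collapse u v k) ⟩
    triple a b d i ∎
    where
    I : ℕ
    I = suc i
    F : ℕ → ℕ → ℕ → ℕ → Carrier
    F j k u v = [ u ℕ.* v ≡ j ] * ([ j ℕ.* k ≡ i ] * (a u * b v * d k))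
    expand : ∀ j k → [ j ℕ.* k ≡ i ] * (conv i j (λ u v → a u * b v) * d k) ≈ ∑[ u < I ] ∑[ v < I ] F j k u v
    expand j k = begin
      [ j ℕ.* k ≡ i ] * (conv i j (λ u v → a u * b v) * d k)
        ≈⟨ solve 3 (λ e s d → e :* (s :* d) := (e :* d) :* s) refl [ j ℕ.* k ≡ i ] _ (d k) ⟩
      ([ j ℕ.* k ≡ i ] * d k) * conv i j (λ u v → a u * b v)
        ≈⟨ trans (*-congˡ (conv-def i j _)) (trans (∑-*ˡ I _ _) (∑-cong I λ u _ → ∑-*ˡ I _ _)) ⟩
      (∑[ u < I ] ∑[ v < I ] (([ j ℕ.* k ≡ i ] * d k) * ([ u ℕ.* v ≡ j ] * (a u * b v))))
        ≈⟨ ∑-cong I (λ u _ → ∑-cong I λ v _ →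
             solve 5 (λ e d e′ a b → (e :* d) :* (e′ :* (a :* b)) := e′ :* (e :* (a :* b :* d))) refl
               [ j ℕ.* k ≡ i ] (d k) [ u ℕ.* v ≡ j ] (a u) (b v)) ⟩
      (∑[ u < I ] ∑[ v < I ] F j k u v) ∎
    collapse : ∀ u v k → ∑[ j < I ] F j k u v ≈ [ (u ℕ.* v) ℕ.* k ≡ i ] * (a u * b v * d k)
    collapse u v k with u ℕ.* v ℕ.<? I
    ... | yes uv<I = trans (∑-single _ uv<I (λ j j≢uv → []-≢ _ (j≢uv ∘ ≡.sym))) ([]-≡ {u ℕ.* v} _ ≡.refl)
    -- No `j` in range equals `u * v`, but then `u * v` exceeds `i`, so the bracket on the right
    -- vanishes as well.
    ... | no uv≮I = trans (∑-zero I λ j j<I → []-≢ _ λ { ≡.refl → uv≮I j<I })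
      (sym ([]-≢ _ λ eq → uv≮I (s≤s (factorˡ≤ (u ℕ.* v) k 1≤i eq))))

  ⋆-assoc : ∀ a b d → ((a ⋆ b) ⋆ d) ≈D (a ⋆ (b ⋆ d))
  ⋆-assoc a b d i 1≤i = begin
    ((a ⋆ b) ⋆ d) i    ≈⟨ [⋆]⋆≈triple a b d 1≤i ⟩
    triple a b d i     ≈⟨ triple-rotate a b d i ⟨
    triple b d a i     ≈⟨ [⋆]⋆≈triple b d a 1≤i ⟨
    ((b ⋆ d) ⋆ a) i    ≈⟨ ⋆-comm (b ⋆ d) a i 1≤i ⟩
    (a ⋆ (b ⋆ d)) i    ∎

  monomial : Carrier → ℕ → DSeries
  monomial r p i = [ p ≡ i ] * r

  monomial-finite : ∀ r p → DegreeAtMost (monomial r p) p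
  monomial-finite r p i p<i = []-≢ r (ℕ.<⇒≢ p<i)

  monomial-⋆ : ∀ r p .{{_ : ℕ.NonZero p}} b k → 1 ℕ.≤ k → (monomial r p ⋆ b) (p ℕ.* k) ≈ r * b k
  monomial-⋆ r p b k 1≤k = trans (⋆≈conv (monomial r p) b {B = p ℕ.* k} (ℕ.*-mono-≤ 1≤p 1≤k) ℕ.≤-refl)
    (trans (conv-single (p ℕ.* k) _ p k (ℕ.m≤m*n p k) (ℕ.m≤n*m k p) ≡.refl λ j′ k′ eq ≢ →
        trans (*-congʳ ([]-≢ r λ { ≡.refl → ≢ (≡.refl , ℕ.*-cancelˡ-≡ k′ k p eq) })) (zeroˡ _))
      (*-congʳ ([]-≡ {p} r ≡.refl)))
    where
    instance
      k≢0 : ℕ.NonZero k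
      k≢0 = ℕ.>-nonZero 1≤k
    1≤p : 1 ℕ.≤ p
    1≤p = ℕ.>-nonZero⁻¹ p

  monomial-⋆-∤ : ∀ r p b {i} → 1 ℕ.≤ i → ¬ p ℕ.∣ i → (monomial r p ⋆ b) i ≈ 0#
  monomial-⋆-∤ r p b {i} 1≤i p∤i = trans (⋆≈conv (monomial r p) b 1≤i ℕ.≤-refl) (conv-zero i λ j k eq →
    trans (*-congʳ ([]-≢ r λ { ≡.refl → p∤i (divides k (≡.trans (≡.sym eq) (ℕ.*-comm j k))) })) (zeroˡ _))

  oneD≈monomial : oneD ≈D monomial 1# 1
  oneD≈monomial (suc zero)    _ = sym ([]-≡ 1# ≡.refl)
  oneD≈monomial (suc (suc i)) _ = sym ([]-≢ 1# λ ())

  constant-⋆ : ∀ r b → (monomial r 1 ⋆ b) ≈D (λ i → r * b i)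
  constant-⋆ r b i 1≤i = ≡.subst (λ k → (monomial r 1 ⋆ b) k ≈ r * b i) (ℕ.*-identityˡ i) (monomial-⋆ r 1 b i 1≤i)

  oneD-⋆ : ∀ b → (oneD ⋆ b) ≈D b
  oneD-⋆ b i 1≤i = trans (⋆-cong {oneD} {monomial 1# 1} {b} {b} oneD≈monomial (λ _ _ → refl) i 1≤i)
    (trans (constant-⋆ 1# b i 1≤i) (*-identityˡ _))

  ⋆-degree≤ : ∀ {a b N M} → DegreeAtMost a N → DegreeAtMost b M → DegreeAtMost (a ⋆ b) (N ℕ.* M)
  ⋆-degree≤ {a} {b} {N} {M} a≤N b≤M i NM<i = trans (⋆≈conv a b (ℕ.≤-trans (s≤s z≤n) NM<i) ℕ.≤-refl) (conv-zero i vanish)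
    where
    vanish : ∀ j k → j ℕ.* k ≡ i → a j * b k ≈ 0#
    vanish j k eq with N ℕ.<? j | M ℕ.<? k
    ... | yes N<j | _       = trans (*-congʳ (a≤N j N<j)) (zeroˡ _)
    ... | no _    | yes M<k = trans (*-congˡ (b≤M k M<k)) (zeroʳ _)
    ... | no N≮j  | no M≮k  = ⊥-elim (ℕ.<⇒≱ NM<i (≡.subst (ℕ._≤ N ℕ.* M) eq (ℕ.*-mono-≤ (ℕ.≮⇒≥ N≮j) (ℕ.≮⇒≥ M≮k))))

  -- If `j * k ≡ N * M` and `j < N`, then `k > M`; the pair `(N , M)` is thus the only one that can
  -- contribute. Hence degrees multiply, where those of ordinary polynomials add.
  ⋆-leading : ∀ {a b N M} → 1 ℕ.≤ N → 1 ℕ.≤ M → DegreeAtMost a N → DegreeAtMost b M →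
              (a ⋆ b) (N ℕ.* M) ≈ a N * b M
  ⋆-leading {a} {b} {N} {M} 1≤N 1≤M a≤N b≤M = trans
    (⋆≈conv a b (ℕ.*-mono-≤ 1≤N 1≤M) ℕ.≤-refl)
    (conv-single (N ℕ.* M) _ N M (ℕ.m≤m*n N M) (ℕ.m≤n*m M N) ≡.refl vanish)
    where
    instance
      N≢0 : ℕ.NonZero N
      N≢0 = ℕ.>-nonZero 1≤N
      M≢0 : ℕ.NonZero M
      M≢0 = ℕ.>-nonZero 1≤M
    vanish : ∀ j k → j ℕ.* k ≡ N ℕ.* M → ¬ (j ≡ N × k ≡ M) → a j * b k ≈ 0#
    vanish j k eq ≢ with ℕ.<-cmp j N
    ... | tri> _ _ N<j = trans (*-congʳ (a≤N j N<j)) (zeroˡ _)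
    ... | tri≈ _ ≡.refl _ = ⊥-elim (≢ (≡.refl , ℕ.*-cancelˡ-≡ k M N eq))
    ... | tri< j<N _ _ with M ℕ.<? k
    ...   | yes M<k = trans (*-congˡ (b≤M k M<k)) (zeroʳ _)
    ...   | no M≮k  = ⊥-elim (ℕ.<⇒≢ (ℕ.≤-<-trans (ℕ.*-monoʳ-≤ j (ℕ.≮⇒≥ M≮k)) (ℕ.*-monoˡ-< M j<N)) eq)

  dirichletRing : CommutativeRing (c ⊔ ℓ) ℓ
  dirichletRing = record
    { Carrier = ∃ Finite
    ; _≈_ = λ a b → proj₁ a ≈D proj₁ b
    ; _+_ = λ { (a , N , a≤N) (b , M , b≤M) → (λ i → a i + b i) , N ℕ.⊔ M , λ i N⊔M<i →
        trans (+-cong (a≤N i (ℕ.m⊔n<o⇒m<o N M N⊔M<i)) (b≤M i (ℕ.m⊔n<o⇒n<o N M N⊔M<i))) (+-identityˡ 0#) }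
    ; _*_ = λ { (a , N , a≤N) (b , M , b≤M) → a ⋆ b , N ℕ.* M , ⋆-degree≤ a≤N b≤M }
    ; -_ = λ { (a , N , a≤N) → (λ i → - a i) , N , λ i N<i → trans (-‿cong (a≤N i N<i)) -0#≈0# }
    ; 0# = (λ _ → 0#) , 0 , λ _ _ → refl
    ; 1# = oneD , 1 , λ { (suc (suc _)) _ → refl ; (suc zero) (s≤s ()) }
    ; isCommutativeRing = record
      { isRing = record
        { +-isAbelianGroup = record
          { isGroup = record
            { isMonoid = record
              { isSemigroup = record
                { isMagma = record
                  { isEquivalence = record
                    { refl = λ _ _ → refl
                    ; sym = λ a≈b i 1≤i → sym (a≈b i 1≤i)
                    ; trans = λ a≈b b≈d i 1≤i → trans (a≈b i 1≤i) (b≈d i 1≤i)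
                    }
                  ; ∙-cong = λ a≈b d≈e i 1≤i → +-cong (a≈b i 1≤i) (d≈e i 1≤i)
                  }
                ; assoc = λ _ _ _ _ _ → +-assoc _ _ _
                }
              ; identity = (λ _ _ _ → +-identityˡ _) , (λ _ _ _ → +-identityʳ _)
              }
            ; inverse = (λ _ _ _ → -‿inverseˡ _) , (λ _ _ _ → -‿inverseʳ _)
            ; ⁻¹-cong = λ a≈b i 1≤i → -‿cong (a≈b i 1≤i)
            }
          ; comm = λ _ _ _ _ → +-comm _ _
          }
        ; *-cong = ⋆-cong
        ; *-assoc = λ { (a , _) (b , _) (d , _) → ⋆-assoc a b d }
        ; *-identity = (λ { (a , _) → oneD-⋆ a }) ,
            (λ { (a , _) i 1≤i → trans (⋆-comm a oneD i 1≤i) (oneD-⋆ a i 1≤i) })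
        ; distrib = (λ { (a , _) (b , _) (d , _) → ⋆-distribˡ a b d }) ,
            (λ { (a , _) (b , _) (d , _) i 1≤i → trans (⋆-comm (λ i → b i + d i) a i 1≤i)
              (trans (⋆-distribˡ a b d i 1≤i) (+-cong (⋆-comm a b i 1≤i) (⋆-comm a d i 1≤i))) })
        }
      ; *-comm = λ { (a , _) (b , _) → ⋆-comm a b }
      }
    }

prime-divisor : ∀ {n} → 2 ℕ.≤ n → ∃ λ p → Prime p × p ℕ.∣ n
prime-divisor {n@(suc _)} 2≤n = go factors isFactorisation factorsPrime
  where
  open PrimeFactorisation (factorise n)
  go : ∀ ps → n ≡ product ps → All Prime ps → ∃ λ p → Prime p × p ℕ.∣ n
  go [] eq _ = ⊥-elim (ℕ.<⇒≢ 2≤n (≡.sym eq))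
  go (p ∷ ps) eq (p-prime ∷ _) = p , p-prime , ≡.subst (p ℕ.∣_) (≡.sym eq) (ℕ.m∣m*n (product ps))

-- Irreducible elements of R are prime

module UFD {c ℓ} (R : CommutativeRing c ℓ) (isUFD : Theory.IsUFD R) where
  open CommutativeRing R hiding (zero)
  open Theory R
  open SetoidReasoning setoid
  open SemiringSolver commutativeSemiring using (solve; _:*_; _:=_)

  1≉0 : ¬ 1# ≈ 0#
  1≉0 = proj₁ (proj₁ isUFD)

  noZeroDivisors : ∀ x y → x * y ≈ 0# → x ≈ 0# ⊎ y ≈ 0#
  noZeroDivisors = proj₂ (proj₁ isUFD)

  factorisation : ∀ a → ¬ a ≈ 0# → ¬ IsUnitR a → ∃ λ xs → All IrreducibleR xs × productR xs ≈ a
  factorisation = proj₁ (proj₂ isUFD)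

  productR-++ : ∀ xs ys → productR (xs ++ ys) ≈ productR xs * productR ys
  productR-++ []       ys = sym (*-identityˡ _)
  productR-++ (x ∷ xs) ys = trans (*-congˡ (productR-++ xs ys)) (sym (*-assoc x _ _))

  lookup-∣R : ∀ xs i → lookup xs i ∣R productR xs
  lookup-∣R (x ∷ xs) zero = productR xs , refl
  lookup-∣R (x ∷ xs) (suc i) with lookup-∣R xs i
  ... | d , eq = x * d , trans (solve 3 (λ l x d → l :* (x :* d) := x :* (l :* d)) refl _ x d) (*-congˡ eq)

  lookup-++-∣R : ∀ xs ys i → lookup (xs ++ ys) i ∣R productR xs ⊎ lookup (xs ++ ys) i ∣R productR ys
  lookup-++-∣R [] ys i = inj₂ (lookup-∣R ys i)
  lookup-++-∣R (x ∷ xs) ys zero = inj₁ (productR xs , refl)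
  lookup-++-∣R (x ∷ xs) ys (suc i) with lookup-++-∣R xs ys i
  ... | inj₁ (d , eq) = inj₁ (x * d , trans (solve 3 (λ l x d → l :* (x :* d) := x :* (l :* d)) refl _ x d) (*-congˡ eq))
  ... | inj₂ l∣ys = inj₂ l∣ys

  ∣R-trans : ∀ {a b d} → a ∣R b → b ∣R d → a ∣R d
  ∣R-trans (e , ae≈b) (f , bf≈d) = e * f , trans (sym (*-assoc _ e f)) (trans (*-congʳ ae≈b) bf≈d)

  ∣R-resp : ∀ {a b d} → a ∣R b → b ≈ d → a ∣R d
  ∣R-resp (e , ae≈b) b≈d = e , trans ae≈b b≈d

  unit-cancel : ∀ {π u y} → IsUnitR u → π ∣R (u * y) → π ∣R y
  unit-cancel {π} {u} {y} (v , uv≈1) (d , πd≈uy) = d * v , (begin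
    π * (d * v)   ≈⟨ *-assoc π d v ⟨
    π * d * v     ≈⟨ *-congʳ πd≈uy ⟩
    u * y * v     ≈⟨ solve 3 (λ u y v → u :* y :* v := (u :* v) :* y) refl u y v ⟩
    (u * v) * y   ≈⟨ *-congʳ uv≈1 ⟩
    1# * y        ≈⟨ *-identityˡ y ⟩
    y             ∎)

  -- For `π * d ≈ x * y`, uniqueness matches `π` with an irreducible factor of `x` or of `y`. The
  -- case distinctions come from `factorisation`, which accepts only nonzero nonunits.
  irreducible⇒prime : ∀ {π x y} → IrreducibleR π → π ∣R (x * y) → ¬ ¬ (π ∣R x ⊎ π ∣R y)
  irreducible⇒prime {π} {x} {y} irr@(_ , _ , splits) π∣xy@(d , πd≈xy) = do
    no x≉0 ← ¬¬-excluded-middle {A = x ≈ 0#}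
      where yes x≈0 → return (inj₁ (0# , trans (zeroʳ π) (sym x≈0)))
    no y≉0 ← ¬¬-excluded-middle {A = y ≈ 0#}
      where yes y≈0 → return (inj₂ (0# , trans (zeroʳ π) (sym y≈0)))
    no x-nonunit ← ¬¬-excluded-middle {A = IsUnitR x}
      where yes x-unit → return (inj₂ (unit-cancel x-unit π∣xy))
    no y-nonunit ← ¬¬-excluded-middle {A = IsUnitR y}
      where yes y-unit → return (inj₁ (unit-cancel y-unit (∣R-resp π∣xy (*-comm x y))))
    -- For a unit `d`, the element `π` is a product of the nonunits `x` and `y * e`, against
    -- irreducibility.
    no d-nonunit ← ¬¬-excluded-middle {A = IsUnitR d}
      where yes (e , de≈1) → ⊥-elim ([ x-nonunit , (λ { (u , yeu≈1) → y-nonunit (e * u , trans (sym (*-assoc y e u)) yeu≈1) }) ]′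
              (splits x (y * e) (begin
                x * (y * e)   ≈⟨ *-assoc x y e ⟨
                x * y * e     ≈⟨ *-congʳ πd≈xy ⟨
                π * d * e     ≈⟨ *-assoc π d e ⟩
                π * (d * e)   ≈⟨ *-congˡ de≈1 ⟩
                π * 1#        ≈⟨ *-identityʳ π ⟩
                π             ∎)))
    let xs , xs-irr , xs≈x = factorisation x x≉0 x-nonunit
    let ys , ys-irr , ys≈y = factorisation y y≉0 y-nonunit
    let ds , ds-irr , ds≈d = factorisation d (λ d≈0 →
          [ x≉0 , y≉0 ]′ (noZeroDivisors x y (trans (sym πd≈xy) (trans (*-congˡ d≈0) (zeroʳ π))))) d-nonunit
    let σ , associated = proj₂ (proj₂ isUFD) (π ∷ ds) (xs ++ ys) (irr ∷ ds-irr) (++⁺ xs-irr ys-irr)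
          (trans (*-congˡ ds≈d) (trans πd≈xy (sym (trans (productR-++ xs ys) (*-cong xs≈x ys≈y)))))
    let u , _ , πu≈l = associated zero
    return ([ (λ l∣xs → inj₁ (∣R-resp (∣R-trans (u , πu≈l) l∣xs) xs≈x)) ,
              (λ l∣ys → inj₂ (∣R-resp (∣R-trans (u , πu≈l) l∣ys) ys≈y)) ]′
            (lookup-++-∣R xs ys (Inverse.to σ zero)))

-- Degrees of Dirichlet polynomials over a domain

module DirichletDegree {c ℓ} (R : CommutativeRing c ℓ)
  (noZeroDivisors : NoZeroDivisors R) (1≉0 : Nontrivial R) where
  open CommutativeRing R hiding (zero)
  open Theory R
  open DirichletConvolution R
  open IntegralDomain R noZeroDivisors 1≉0 using (*-≉0)

  lower-degree : ∀ {a n} → DegreeAtMost a (suc n) → a (suc n) ≈ 0# → DegreeAtMost a n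
  lower-degree {n = n} a≤ a≈0 i n<i with ℕ.m≤n⇒m<n∨m≡n n<i
  ... | inj₁ 1+n<i  = a≤ i 1+n<i
  ... | inj₂ ≡.refl = a≈0

  -- The bounds need not be attained, as coefficients cannot be tested for zero. The coefficients at
  -- the bounds have product zero, and the disjunction for `R` tells which bound to lower; so the
  -- disjunction obtained is genuine.
  zero-product : ∀ N M {a b} → DegreeAtMost a N → DegreeAtMost b M → IsZeroD (a ⋆ b) → IsZeroD a ⊎ IsZeroD b
  zero-product zero M a≤ b≤ ab≈0 = inj₁ a≤
  zero-product (suc N) zero a≤ b≤ ab≈0 = inj₂ b≤
  zero-product (suc N) (suc M) {a} {b} a≤ b≤ ab≈0
    with noZeroDivisors _ _ (trans (sym (⋆-leading {a} {b} (s≤s z≤n) (s≤s z≤n) a≤ b≤)) (ab≈0 (suc N ℕ.* suc M) (s≤s z≤n)))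
  ... | inj₁ a≈0 = zero-product N (suc M) (lower-degree a≤ a≈0) b≤ ab≈0
  ... | inj₂ b≈0 = zero-product (suc N) M a≤ (lower-degree b≤ b≈0) ab≈0

  -- The known degree `d` of the product replaces zero tests. While the bounds multiply to more than
  -- `d`, the coefficients at the bounds have product zero and one bound drops; at equality both
  -- coefficients are nonzero and the bounds are the degrees.
  factor-degrees : ∀ N M {a b d} → DegreeAtMost a N → DegreeAtMost b M → HasDegree (a ⋆ b) d →
                   ∃₂ λ n m → HasDegree a n × HasDegree b m × n ℕ.* m ≡ d
  factor-degrees zero M {a} {b} {d} a≤ b≤ (1≤d , ab≉0 , _) =
    ⊥-elim (ab≉0 (⋆-degree≤ {a} {b} a≤ b≤ d 1≤d))
  factor-degrees (suc N) zero {a} {b} {d} a≤ b≤ (1≤d , ab≉0 , _) =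
    ⊥-elim (ab≉0 (⋆-degree≤ {a} {b} a≤ b≤ d (≡.subst (ℕ._< d) (≡.sym (ℕ.*-zeroʳ N)) 1≤d)))
  factor-degrees (suc N) (suc M) {a} {b} {d} a≤ b≤ δ@(1≤d , ab≉0 , ab≤d) with ℕ.<-cmp (suc N ℕ.* suc M) d
  ... | tri< NM<d _ _ = ⊥-elim (ab≉0 (⋆-degree≤ {a} {b} a≤ b≤ d NM<d))
  ... | tri≈ _ ≡.refl _ = suc N , suc M ,
    (s≤s z≤n , (λ a≈0 → ab≉0 (trans leading (trans (*-congʳ a≈0) (zeroˡ _)))) , a≤) ,
    (s≤s z≤n , (λ b≈0 → ab≉0 (trans leading (trans (*-congˡ b≈0) (zeroʳ _)))) , b≤) , ≡.refl
    where
    leading : (a ⋆ b) (suc N ℕ.* suc M) ≈ a (suc N) * b (suc M)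
    leading = ⋆-leading {a} {b} (s≤s z≤n) (s≤s z≤n) a≤ b≤
  ... | tri> _ _ d<NM
    with noZeroDivisors _ _ (trans (sym (⋆-leading {a} {b} (s≤s z≤n) (s≤s z≤n) a≤ b≤)) (ab≤d (suc N ℕ.* suc M) d<NM))
  ...   | inj₁ a≈0 = factor-degrees N (suc M) (lower-degree a≤ a≈0) b≤ δ
  ...   | inj₂ b≈0 = factor-degrees (suc N) M a≤ (lower-degree b≤ b≈0) δ

  degree≤ : ∀ {a n m} → HasDegree a n → DegreeAtMost a m → n ℕ.≤ m
  degree≤ {n = n} {m} (_ , a≉0 , _) a≤ = ℕ.≮⇒≥ λ m<n → a≉0 (a≤ n m<n)

  degree-unique : ∀ {a n m} → HasDegree a n → HasDegree a m → n ≡ m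
  degree-unique {a} δ@(_ , _ , a≤n) ε@(_ , _ , a≤m) = ℕ.≤-antisym (degree≤ {a} δ a≤m) (degree≤ {a} ε a≤n)

  degree-resp : ∀ {a b n} → a ≈D b → HasDegree a n → HasDegree b n
  degree-resp a≈b (1≤n , a≉0 , a≤n) = 1≤n , (λ b≈0 → a≉0 (trans (a≈b _ 1≤n) b≈0)) ,
    λ i n<i → trans (sym (a≈b i (ℕ.≤-trans 1≤n (ℕ.<⇒≤ n<i)))) (a≤n i n<i)

  ⋆-degree : ∀ {a b n m} → HasDegree a n → HasDegree b m → HasDegree (a ⋆ b) (n ℕ.* m)
  ⋆-degree {a} {b} (1≤n , a≉0 , a≤n) (1≤m , b≉0 , b≤m) = ℕ.*-mono-≤ 1≤n 1≤m ,
    (λ ab≈0 → *-≉0 a≉0 b≉0 (trans (sym (⋆-leading {a} {b} 1≤n 1≤m a≤n b≤m)) ab≈0)) , ⋆-degree≤ {a} {b} a≤n b≤m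

  nonzero-degree : ∀ N {a} → DegreeAtMost a N → ¬ IsZeroD a → ¬ ¬ ∃ λ n → HasDegree a n
  nonzero-degree zero a≤ a≉0 = ⊥-elim (a≉0 a≤)
  nonzero-degree (suc N) {a} a≤ a≉0 = do
    no aN≉0 ← ¬¬-excluded-middle {A = a (suc N) ≈ 0#}
      where yes aN≈0 → nonzero-degree N (lower-degree a≤ aN≈0) a≉0
    return (suc N , s≤s z≤n , aN≉0 , a≤)

  monomial-degree : ∀ {r p} → 1 ℕ.≤ p → ¬ r ≈ 0# → HasDegree (monomial r p) p
  monomial-degree {r} {p} 1≤p r≉0 = 1≤p , (λ eq → r≉0 (trans (sym ([]-≡ {p} r ≡.refl)) eq)) , monomial-finite r p

  oneD-degree : HasDegree oneD 1
  oneD-degree = degree-resp (λ i 1≤i → sym (oneD≈monomial i 1≤i)) (monomial-degree (s≤s z≤n) 1≉0)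

prime≥2 : ∀ {p} → Prime p → 2 ℕ.≤ p
prime≥2 {zero} p-prime = ⊥-elim (¬prime[0] p-prime)
prime≥2 {suc zero} p-prime = ⊥-elim (¬prime[1] p-prime)
prime≥2 {suc (suc p)} _ = s≤s (s≤s z≤n)

-- Factorisation in the subrings of smooth support

module SmoothSubrings {c ℓ} (R : CommutativeRing c ℓ) (isUFD : Theory.IsUFD R) where
  open CommutativeRing R hiding (zero)
  open Theory R
  open RingProperties ring using (-0#≈0#)
  open UFD R isUFD
  open DirichletConvolution R
  open DirichletDegree R noZeroDivisors 1≉0

  open CommutativeRing dirichletRing using () renaming
    (Carrier to DPoly; _≈_ to _≈ᴰ_; _*_ to _*ᴰ_; _+_ to _+ᴰ_; 0# to 0ᴰ; 1# to 1ᴰ)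

  1ᴰ≉0ᴰ : ¬ 1ᴰ ≈ᴰ 0ᴰ
  1ᴰ≉0ᴰ 1≈0 = 1≉0 (1≈0 1 (s≤s z≤n))

  noZeroDivisorsᴰ : ∀ x y → x *ᴰ y ≈ᴰ 0ᴰ → x ≈ᴰ 0ᴰ ⊎ y ≈ᴰ 0ᴰ
  noZeroDivisorsᴰ (a , N , a≤) (b , M , b≤) = zero-product N M {a} {b} a≤ b≤

  open IntegralDomain dirichletRing noZeroDivisorsᴰ 1ᴰ≉0ᴰ public using (module Factorisations; module Extension)

  -- Supported on integers whose prime factors are all < k; a record, so that a can be
  -- inferred from a proof.
  record Smooth (k : ℕ) (a : DPoly) : Set ℓ where
    constructor smooth
    field vanishes : ∀ i p → 1 ℕ.≤ i → Prime p → k ℕ.≤ p → p ℕ.∣ i → proj₁ a i ≈ 0#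
  open Smooth

  ∣⇒≤ : ∀ {p i} → 1 ℕ.≤ i → p ℕ.∣ i → p ℕ.≤ i
  ∣⇒≤ {p} {suc i} 1≤i p∣i = ℕ.∣⇒≤ p∣i

  degree<⇒smooth : ∀ {k n} ((a , fin) : DPoly) → n ℕ.< k → DegreeAtMost a n → Smooth k (a , fin)
  degree<⇒smooth a n<k a≤n = smooth λ i p 1≤i p-prime k≤p p∣i → a≤n i (ℕ.<-≤-trans n<k (ℕ.≤-trans k≤p (∣⇒≤ 1≤i p∣i)))

  degree1⇒smooth : ∀ k ((a , fin) : DPoly) → DegreeAtMost a 1 → Smooth k (a , fin)
  degree1⇒smooth k a a≤1 = smooth λ i p 1≤i p-prime k≤p p∣i → a≤1 i (ℕ.≤-trans (prime≥2 p-prime) (∣⇒≤ 1≤i p∣i))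

  smooth-subring : ∀ k → IsSubring dirichletRing (Smooth k)
  smooth-subring k = record
    { resp = λ a≈b a∈ → smooth λ i p 1≤i p-prime k≤p p∣i → trans (sym (a≈b i 1≤i)) (vanishes a∈ i p 1≤i p-prime k≤p p∣i)
    ; 0∈   = smooth λ _ _ _ _ _ _ → refl
    ; 1∈   = degree1⇒smooth k 1ᴰ (proj₂ (proj₂ 1ᴰ))
    ; +∈   = λ a∈ b∈ → smooth λ i p 1≤i p-prime k≤p p∣i →
        trans (+-cong (vanishes a∈ i p 1≤i p-prime k≤p p∣i) (vanishes b∈ i p 1≤i p-prime k≤p p∣i)) (+-identityˡ 0#)
    ; *∈   = smooth-⋆
    ; -∈   = λ a∈ → smooth λ i p 1≤i p-prime k≤p p∣i → trans (-‿cong (vanishes a∈ i p 1≤i p-prime k≤p p∣i)) -0#≈0#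
    }
    where
    smooth-⋆ : ∀ {a b} → Smooth k a → Smooth k b → Smooth k (a *ᴰ b)
    smooth-⋆ {a , _} {b , _} a∈ b∈ = smooth λ i p 1≤i p-prime k≤p p∣i →
      trans (⋆≈conv a b 1≤i ℕ.≤-refl) (conv-zero i (vanish 1≤i p-prime k≤p p∣i))
      where
      vanish : ∀ {i p} → 1 ℕ.≤ i → Prime p → k ℕ.≤ p → p ℕ.∣ i → ∀ j l → j ℕ.* l ≡ i → a j * b l ≈ 0#
      vanish {p = p} 1≤i p-prime k≤p p∣i j k eq with euclidsLemma j k p-prime (≡.subst (p ℕ.∣_) (≡.sym eq) p∣i)
      ... | inj₁ p∣j = trans (*-congʳ (vanishes a∈ j p (factorˡ≥1 j k 1≤i eq) p-prime k≤p p∣j)) (zeroˡ _)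
      ... | inj₂ p∣k = trans (*-congˡ (vanishes b∈ k p (factorʳ≥1 j k 1≤i eq) p-prime k≤p p∣k)) (zeroʳ _)

  open Divisibility dirichletRing using (PrimeFactorial)

  constant : Carrier → DPoly
  constant r = monomial r 1 , 1 , monomial-finite r 1

  constant∈ : ∀ k r → Smooth k (constant r)
  constant∈ k r = degree1⇒smooth k (constant r) (monomial-finite r 1)

  smooth0⇒degree≤1 : ∀ {a} → Smooth 0 a → DegreeAtMost (proj₁ a) 1
  smooth0⇒degree≤1 a∈ i 1<i with prime-divisor 1<i
  ... | p , p-prime , p∣i = vanishes a∈ i p (ℕ.<⇒≤ 1<i) p-prime z≤n p∣i

  degree≤1⇒constant : ∀ {a} → DegreeAtMost a 1 → monomial (a 1) 1 ≈D a
  degree≤1⇒constant a≤1 (suc zero) _ = []-≡ {1} _ ≡.refl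
  degree≤1⇒constant a≤1 (suc (suc i)) _ = trans ([]-≢ _ λ ()) (sym (a≤1 _ (s≤s (s≤s z≤n))))

  constant-*-at-1 : ∀ r b → (monomial r 1 ⋆ b) 1 ≈ r * b 1
  constant-*-at-1 r b = constant-⋆ r b 1 (s≤s z≤n)

  constant-* : ∀ r s → (monomial r 1 ⋆ monomial s 1) ≈D monomial (r * s) 1
  constant-* r s i 1≤i = trans (constant-⋆ r (monomial s 1) i 1≤i)
    (trans (sym (*-assoc r _ s)) (trans (*-congʳ (*-comm r _)) (*-assoc _ r s)))

  constant-cong : ∀ {r s} → r ≈ s → monomial r 1 ≈D monomial s 1
  constant-cong r≈s i _ = *-congˡ r≈s

  -- Every index above 1 has a prime factor, so this stage consists of the constants. It is a copy
  -- of `R`, with the coefficient at 1 as the isomorphism.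
  base : PrimeFactorial (Smooth 0)
  base a a∈ a≉0 = do
    no a-nonunit ← ¬¬-excluded-middle {A = IsUnitR (proj₁ a 1)}
      where yes a-unit → return (unit (∣R⇒∣ {a} {1ᴰ} a∈ 1∈ a-unit))
    let xs , xs-irr , xs≈a = UFD.factorisation R isUFD (proj₁ a 1)
          (λ a₁≈0 → a≉0 (λ i 1≤i → trans (sym (a≈ i 1≤i)) (trans (*-congˡ a₁≈0) (zeroʳ _)))) a-nonunit
    return (factorisation-resp {constant (productR xs)} {a} (λ i 1≤i → trans (*-congˡ xs≈a) (a≈ i 1≤i)) (product-factorisation xs xs-irr))
    where
    open Divisibility dirichletRing (Smooth 0)
    open Factorisations (smooth-subring 0) using (factorisation-resp)
    open IsSubring (smooth-subring 0) using (1∈)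
    a≈ : monomial (proj₁ a 1) 1 ≈D proj₁ a
    a≈ = degree≤1⇒constant (smooth0⇒degree≤1 a∈)
    ∣R⇒∣ : ∀ {a b} → Smooth 0 a → Smooth 0 b → proj₁ a 1 ∣R proj₁ b 1 → a ∣ b
    ∣R⇒∣ {a} {b} a∈ b∈ (d , ad≈b) = constant d , constant∈ 0 d , λ i 1≤i → begin
      (proj₁ a ⋆ monomial d 1) i
        ≈⟨ ⋆-cong {proj₁ a} {monomial (proj₁ a 1) 1} {monomial d 1} {monomial d 1}
             (λ j 1≤j → sym (degree≤1⇒constant (smooth0⇒degree≤1 a∈) j 1≤j)) (λ _ _ → refl) i 1≤i ⟩
      (monomial (proj₁ a 1) 1 ⋆ monomial d 1) i   ≈⟨ constant-* _ d i 1≤i ⟩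
      monomial (proj₁ a 1 * d) 1 i                ≈⟨ constant-cong ad≈b i 1≤i ⟩
      monomial (proj₁ b 1) 1 i                    ≈⟨ degree≤1⇒constant (smooth0⇒degree≤1 b∈) i 1≤i ⟩
      proj₁ b i                                   ∎
      where
      open SetoidReasoning setoid
    at-1 : ∀ {a b} → DegreeAtMost a 1 → DegreeAtMost b 1 → (a ⋆ b) 1 ≈ a 1 * b 1
    at-1 {a} {b} a≤1 b≤1 = ⋆-leading {a} {b} (s≤s z≤n) (s≤s z≤n) a≤1 b≤1
    ∣⇒∣R : ∀ {π b} → constant π ∣ b → π ∣R proj₁ b 1
    ∣⇒∣R {π} ((d , _) , _ , πd≈b) = d 1 , trans (sym (constant-*-at-1 π d)) (πd≈b 1 (s≤s z≤n))
    constant-prime : ∀ {π} → IrreducibleR π → IsPrime (constant π)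
    constant-prime {π} irr@(π≉0 , π-nonunit , _) = record
      { ∈S      = constant∈ 0 π
      ; ≉0      = λ π≈0 → π≉0 (trans (sym ([]-≡ {1} π ≡.refl)) (π≈0 1 (s≤s z≤n)))
      ; nonunit = λ π∣1 → π-nonunit (∣⇒∣R {π} {1ᴰ} π∣1)
      ; split   = λ {a} {b} a∈ b∈ π∣ab → do
          let π∣a₁b₁ = ∣R-resp (∣⇒∣R {π} {a *ᴰ b} π∣ab) (at-1 (smooth0⇒degree≤1 a∈) (smooth0⇒degree≤1 b∈))
          inj₁ π∣a₁ ← irreducible⇒prime irr π∣a₁b₁
            where inj₂ π∣b₁ → return (inj₂ (∣R⇒∣ {constant π} {b} (constant∈ 0 π) b∈ (∣R-trans (1# , trans (*-identityʳ _) ([]-≡ {1} π ≡.refl)) π∣b₁)))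
          return (inj₁ (∣R⇒∣ {constant π} {a} (constant∈ 0 π) a∈ (∣R-trans (1# , trans (*-identityʳ _) ([]-≡ {1} π ≡.refl)) π∣a₁)))
      }
    product-factorisation : ∀ xs → All IrreducibleR xs → Factorisation (constant (productR xs))
    product-factorisation [] [] = unit (∣R⇒∣ {constant 1#} {1ᴰ} (constant∈ 0 1#) 1∈ (1# , trans (*-identityʳ _) ([]-≡ {1} 1# ≡.refl)))
    product-factorisation (x ∷ xs) (x-irr ∷ xs-irr) =
      cons (constant-prime x-irr) (constant∈ 0 _) (product-factorisation xs xs-irr) (constant-* x (productR xs))

  -- Adjoining the indeterminate of one prime

  module AdjoinPrime (p : ℕ) (p-prime : Prime p) where
    instance
      p≢0 : ℕ.NonZero p
      p≢0 = prime⇒nonZero p-prime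

    1≤p : 1 ℕ.≤ p
    1≤p = ℕ.>-nonZero⁻¹ p

    X : DPoly
    X = monomial 1# p , p , monomial-finite 1# p

    X-∣ : ∀ b k → 1 ℕ.≤ k → (proj₁ X ⋆ b) (p ℕ.* k) ≈ b k
    X-∣ b k 1≤k = trans (monomial-⋆ 1# p b k 1≤k) (*-identityˡ _)

    X∈ : Smooth (suc p) X
    X∈ = degree<⇒smooth X ℕ.≤-refl (monomial-finite 1# p)

    smooth-suc : ∀ {a} → Smooth p a → Smooth (suc p) a
    smooth-suc a∈ = smooth λ i q 1≤i q-prime p<q → vanishes a∈ i q 1≤i q-prime (ℕ.<⇒≤ p<q)

    open Polynomials dirichletRing (Smooth p) X

    unless : ∀ {A : Set} → Dec A → Carrier → Carrier
    unless (yes _) _ = 0#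
    unless (no _)  x = x

    unless-yes : ∀ {A : Set} (A? : Dec A) {x} → A → unless A? x ≈ 0#
    unless-yes (yes _) _ = refl
    unless-yes (no ¬A) A = ⊥-elim (¬A A)

    unless-zero : ∀ {A : Set} (A? : Dec A) {x} → x ≈ 0# → unless A? x ≈ 0#
    unless-zero (yes _) _ = refl
    unless-zero (no _) x≈0 = x≈0

    -- The Horner step separates the indices not divisible by `p` from the multiples of `p`. The
    -- Dirichlet degree bound `N` serves as recursion measure and generously bounds the degree in
    -- `X`.
    polynomial : ∀ N a {fin} → DegreeAtMost a N → Smooth (suc p) (a , fin) → Poly N (a , fin)
    polynomial zero a a≤ a∈ = pzero a≤
    polynomial (suc N) a a≤ a∈ = psuc {c = head} {b = tail} head∈ (polynomial N (proj₁ tail) (proj₂ (proj₂ tail)) tail∈) split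
      where
      head : DPoly
      head = (λ i → unless (p ∣? i) (a i)) , suc N , λ i N<i → unless-zero (p ∣? i) (a≤ i N<i)
      tail : DPoly
      -- From `i > N` follows `p * i ≥ 2 * i > N + 1`, so the bound drops by one.
      tail = (λ i → a (p ℕ.* i)) , N , λ i N<i →
        a≤ (p ℕ.* i) (ℕ.≤-trans (ℕ.+-mono-≤ (ℕ.≤-trans (s≤s z≤n) N<i) N<i) (ℕ.≤-trans
          (ℕ.≤-reflexive (≡.cong (i ℕ.+_) (≡.sym (ℕ.+-identityʳ i)))) (ℕ.*-monoˡ-≤ i (prime≥2 p-prime))))
      head∈ : Smooth p head
      head∈ = smooth λ i q 1≤i q-prime p≤q q∣i →
        [ (λ p<q → unless-zero (p ∣? i) (vanishes a∈ i q 1≤i q-prime p<q q∣i)) ,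
          (λ { ≡.refl → unless-yes (p ∣? i) q∣i }) ]′ (ℕ.m≤n⇒m<n∨m≡n p≤q)
      tail∈ : Smooth (suc p) tail
      tail∈ = smooth λ i q 1≤i q-prime p<q q∣i → vanishes a∈ (p ℕ.* i) q (ℕ.*-mono-≤ 1≤p 1≤i) q-prime p<q (ℕ.∣n⇒∣m*n p q∣i)
      split : ∀ i → 1 ℕ.≤ i → unless (p ∣? i) (a i) + (proj₁ X ⋆ proj₁ tail) i ≈ a i
      split i 1≤i with p ∣? i
      ... | no p∤i = trans (+-congˡ (monomial-⋆-∤ 1# p (proj₁ tail) 1≤i p∤i)) (+-identityʳ _)
      ... | yes (divides k i≡k*p) = trans (+-identityˡ _) (≡.subst (λ j → (proj₁ X ⋆ proj₁ tail) j ≈ a j)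
              p*k≡i (X-∣ (proj₁ tail) k (factorʳ≥1 p k 1≤i p*k≡i)))
        where
        p*k≡i : p ℕ.* k ≡ i
        p*k≡i = ≡.trans (ℕ.*-comm p k) (≡.sym i≡k*p)

    -- The supports are disjoint: `a` vanishes at all multiples of `p`, and `X *ᴰ b` at all other
    -- indices.
    transcendental : ∀ {a b} → Smooth p a → Smooth (suc p) b → a +ᴰ X *ᴰ b ≈ᴰ 0ᴰ → a ≈ᴰ 0ᴰ × b ≈ᴰ 0ᴰ
    transcendental {a} {b} a∈ b∈ a+Xb≈0 = a≈0 , λ k 1≤k → trans (sym (X-∣ (proj₁ b) k 1≤k))
      (trans (sym (trans (+-congʳ (a≈0 _ (ℕ.*-mono-≤ 1≤p 1≤k))) (+-identityˡ _))) (a+Xb≈0 _ (ℕ.*-mono-≤ 1≤p 1≤k)))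
      where
      a≈0 : a ≈ᴰ 0ᴰ
      a≈0 i 1≤i with p ∣? i
      ... | yes p∣i = vanishes a∈ i p 1≤i p-prime ℕ.≤-refl p∣i
      ... | no p∤i  = trans (sym (trans (+-congˡ (monomial-⋆-∤ 1# p (proj₁ b) 1≤i p∤i)) (+-identityʳ _))) (a+Xb≈0 i 1≤i)

    step : PrimeFactorial (Smooth p) → PrimeFactorial (Smooth (suc p))
    step = Extension.primeFactorial-extension (smooth-subring p) (smooth-subring (suc p)) X X∈
      smooth-suc (λ { {a , N , a≤} a∈ → N , polynomial N a a≤ a∈ }) transcendental

  primeFactorial : ∀ k → PrimeFactorial (Smooth k)
  primeFactorial zero = base
  primeFactorial (suc k) with prime? k
  ... | yes k-prime = AdjoinPrime.step k k-prime (primeFactorial k)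
  ... | no k-notprime = SameSubring.PrimeFactorial-to dirichletRing
    (λ a∈ → smooth λ i p 1≤i p-prime k<p → vanishes a∈ i p 1≤i p-prime (ℕ.<⇒≤ k<p))
    (λ a∈ → smooth λ i p 1≤i p-prime k≤p → vanishes a∈ i p 1≤i p-prime (ℕ.≤∧≢⇒< k≤p λ { ≡.refl → k-notprime p-prime }))
    (primeFactorial k)

open import Data.Nat using (_≤_; _*_)
open import Data.Nat.Divisibility using (_∣_)

-- Divisibility by an element without repeated primes

module SquareFreeDivisors {c ℓ} (T : CommutativeRing c ℓ) {s} {S : CommutativeRing.Carrier T → Set s} (subring : IsSubring T S) where
  open CommutativeRing T hiding (zero) renaming (_*_ to _·_)
  open IsSubring subring
  open Divisibility T S renaming (_∣_ to _∣ˢ_)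
  open SemiringSolver commutativeSemiring using (solve; _:*_; _:=_)

  -- Here `e` is the part of `f` already found in `g`. The next prime of `f′` divides `e * g′`;
  -- dividing `e` would make its square divide `f`, so it divides `g′` and moves into `e`.
  factorisation-divides : ∀ {f g f′ e g′} → Factorisation f′ → S e → S f′ → S g′ → e · f′ ≈ f → e · g′ ≈ g →
    (∀ {π} → IsPrime π → π ∣ˢ f → ¬ ¬ π ∣ˢ g) → (∀ {π} → IsPrime π → ¬ π · π ∣ˢ f) → ¬ ¬ f ∣ˢ g
  factorisation-divides {f} {g} {f′} {e} {g′} (unit (u , u∈ , f′u≈1)) e∈ f′∈ g′∈ ef′≈f eg′≈g _ _ =
    return (u · g′ , *∈ u∈ g′∈ , trans (*-congʳ (sym ef′≈f)) (trans
      (solve 4 (λ e f u g → (e :* f) :* (u :* g) := (f :* u) :* (e :* g)) refl e f′ u g′)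
      (trans (*-cong f′u≈1 eg′≈g) (*-identityˡ g))))
  factorisation-divides {f} {g} {f′} {e} {g′} (cons {π} {b} prime b∈ φ πb≈f′) e∈ f′∈ g′∈ ef′≈f eg′≈g f∣g □-free = do
    (t , t∈ , πt≈g) ← f∣g prime (e · b , *∈ e∈ b∈ ,
      trans (solve 3 (λ p e b → p :* (e :* b) := e :* (p :* b)) refl π e b) (trans (*-congˡ πb≈f′) ef′≈f))
    inj₂ (g″ , g″∈ , πg″≈g′) ← split e∈ g′∈ (t , t∈ , trans πt≈g (sym eg′≈g))
      where inj₁ (t′ , t′∈ , πt′≈e) → ⊥-elim (□-free prime (t′ · b , *∈ t′∈ b∈ ,
              trans (solve 3 (λ p t b → (p :* p) :* (t :* b) := (p :* t) :* (p :* b)) refl π t′ b)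
                (trans (*-cong πt′≈e πb≈f′) ef′≈f)))
    factorisation-divides φ (*∈ e∈ ∈S) b∈ g″∈
      (trans (*-assoc e π b) (trans (*-congˡ πb≈f′) ef′≈f))
      (trans (*-assoc e π g″) (trans (*-congˡ πg″≈g′) eg′≈g)) f∣g □-free
    where open IsPrime prime

  -- With `f = q² h`, the square of `x q h` is `f` times `x² h`; `w` carries the remaining power.
  square-identity : ∀ x q h w → ((q · q) · h) · (x · (x · (h · w))) ≈ (x · (q · h)) · ((x · (q · h)) · w)
  square-identity = solve 4 (λ x q h w →
    ((q :* q) :* h) :* (x :* (x :* (h :* w))) := (x :* (q :* h)) :* ((x :* (q :* h)) :* w)) refl

-- Square-freeness and divisibility of powers

module Proof {c ℓ} (R : CommutativeRing c ℓ) (isUFD : Theory.IsUFD R)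
  (f : Theory.DSeries R) (n : ℕ) (f-primitive : Theory.PrimitiveD R f) (f-degree : Theory.HasDegree R f n) where
  open CommutativeRing R hiding (zero; _*_)
  open Theory R
  open UFD R isUFD
  open DirichletConvolution R
  open DirichletDegree R noZeroDivisors 1≉0
  open SmoothSubrings R isUFD
  open CommutativeRing dirichletRing using () renaming
    (Carrier to DPoly; _≈_ to _≈ᴰ_; _*_ to _*ᴰ_; 0# to 0ᴰ; 1# to 1ᴰ; trans to transᴰ; sym to symᴰ;
     *-assoc to *ᴰ-assoc; *-comm to *ᴰ-comm; *-congˡ to *ᴰ-congˡ; *-congʳ to *ᴰ-congʳ; zeroʳ to *ᴰ-zeroʳ)

  F : DPoly
  F = f , n , proj₂ (proj₂ f-degree)

  -- The constant coefficient of `x` divides every coefficient of `f`, so primitivity makes it a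
  -- unit of `R`.
  constant-divisor-unit : ∀ (x y : DPoly) → DegreeAtMost (proj₁ x) 1 → x *ᴰ y ≈ᴰ F → IsUnitD (proj₁ x)
  constant-divisor-unit x@(a , _) y@(b , _) a≤1 xy≈f with f-primitive (a 1) (λ i 1≤i → b i ,
    trans (sym (constant-⋆ (a 1) b i 1≤i)) (trans (⋆-cong {b = b} (degree≤1⇒constant a≤1) (λ _ _ → refl) i 1≤i) (xy≈f i 1≤i)))
  ... | d , a₁d≈1 = monomial d 1 , (1 , monomial-finite d 1) , λ i 1≤i → trans
    (⋆-cong {b = monomial d 1} (λ j 1≤j → sym (degree≤1⇒constant {a} a≤1 j 1≤j)) (λ _ _ → refl) i 1≤i)
    (trans (constant-* (a 1) d i 1≤i) (trans (constant-cong a₁d≈1 i 1≤i) (sym (oneD≈monomial i 1≤i))))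

  factors-of-degree : ∀ {d} (x y : DPoly) → HasDegree (proj₁ (x *ᴰ y)) d →
                      ∃₂ λ k l → HasDegree (proj₁ x) k × HasDegree (proj₁ y) l × k * l ≡ d
  factors-of-degree (a , N , a≤) (b , M , b≤) = factor-degrees N M {a} {b} a≤ b≤

  factors-of-f : ∀ (x y : DPoly) → x *ᴰ y ≈ᴰ F →
                 ∃₂ λ k l → HasDegree (proj₁ x) k × HasDegree (proj₁ y) l × k * l ≡ n
  factors-of-f x y xy≈f = factors-of-degree x y (degree-resp (symᴰ {x *ᴰ y} {F} xy≈f) f-degree)

  degree-1 : ∀ {a k} → HasDegree a k → k ≡ 1 → DegreeAtMost a 1
  degree-1 (_ , _ , a≤) ≡.refl = a≤

  unit-degree : ∀ (x : DPoly) → IsUnitD (proj₁ x) → DegreeAtMost (proj₁ x) 1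
  unit-degree x (h , h-fin , xh≈1) with factors-of-degree x (h , h-fin) (degree-resp (λ i 1≤i → sym (xh≈1 i 1≤i)) oneD-degree)
  ... | k , l , δ , _ , kl≡1 = degree-1 δ (ℕ.m*n≡1⇒m≡1 k l kl≡1)

  _^ᴰ_ : DPoly → ℕ → DPoly
  g ^ᴰ zero  = 1ᴰ
  g ^ᴰ suc m = g *ᴰ (g ^ᴰ m)

  ^ᴰ-underlying : ∀ g m → proj₁ (g ^ᴰ m) ≡ proj₁ g ^D m
  ^ᴰ-underlying g zero = ≡.refl
  ^ᴰ-underlying g (suc m) = ≡.cong (proj₁ g ⋆_) (^ᴰ-underlying g m)

  module _ (K : ℕ) (n<K : n ℕ.< K) where
    open Divisibility dirichletRing (Smooth K) renaming (_∣_ to _∣ˢ_)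
    open IsSubring (smooth-subring K)

    divisor-smooth : ∀ {d} (x : DPoly) → HasDegree (proj₁ x) d → d ≤ n → Smooth K x
    divisor-smooth x (_ , _ , x≤) d≤n = degree<⇒smooth x (ℕ.≤-<-trans d≤n n<K) x≤

    -- The disjunction demanded by IrreducibleD is decided by degrees: if x y = π, then
    -- deg x and deg y are computable from deg π, and one of them must be 1; that factor is
    -- a constant dividing f, hence a unit as f is primitive.
    prime⇒irreducible : ∀ {π} → IsPrime π → π ∣ˢ F → IrreducibleD (proj₁ π)
    prime⇒irreducible {π} π-prime (e , e∈ , πe≈f) with factors-of-f π e πe≈f
    ... | d , d′ , δ@(1≤d , πd≉0 , π≤d) , δ′@(1≤d′ , _) , dd′≡n =
      proj₂ π , ≉0 , π-nonunit , irreducible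
      where
      open IsPrime π-prime
      instance
        d≢0 : ℕ.NonZero d
        d≢0 = ℕ.>-nonZero 1≤d
        d′≢0 : ℕ.NonZero d′
        d′≢0 = ℕ.>-nonZero 1≤d′
      d≤n : d ≤ n
      d≤n = ≡.subst (d ≤_) dd′≡n (ℕ.m≤m*n d d′)
      π-nonunit : ¬ IsUnitD (proj₁ π)
      π-nonunit π-unit@(h , h-fin , πh≈1) = nonunit ((h , h-fin) , degree1⇒smooth K (h , h-fin)
        (unit-degree (h , h-fin) (proj₁ π , proj₂ π , λ i 1≤i → trans (⋆-comm h (proj₁ π) i 1≤i) (πh≈1 i 1≤i))) , πh≈1)
      degree-∤ : ∀ {k} (x : DPoly) → HasDegree (proj₁ x) k → k ℕ.< d → ¬ π ∣ˢ x
      degree-∤ x ε@(1≤k , _) k<d (z , _ , πz≈x) with factors-of-degree π z (degree-resp (symᴰ {π *ᴰ z} {x} πz≈x) ε)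
      ... | d₁ , l , δ₁ , (1≤l , _) , d₁l≡k =
        ℕ.<⇒≱ k<d (≡.subst₂ _≤_ (degree-unique {proj₁ π} δ₁ δ) d₁l≡k (ℕ.m≤m*n d₁ l {{ℕ.>-nonZero 1≤l}}))
      irreducible : ∀ x y → Finite x → Finite y → (x ⋆ y) ≈D proj₁ π → IsUnitD x ⊎ IsUnitD y
      irreducible x y x-fin y-fin xy≈π
        with factors-of-degree (x , x-fin) (y , y-fin) (degree-resp (λ i 1≤i → sym (xy≈π i 1≤i)) δ)
      ... | k , l , κ@(1≤k , _) , λ′@(1≤l , _) , kl≡d with k ℕ.≟ 1 | l ℕ.≟ 1
      ...   | yes k≡1 | _ = inj₁ (constant-divisor-unit X (Y *ᴰ e) (degree-1 κ k≡1)
              (transᴰ {X *ᴰ (Y *ᴰ e)} {(X *ᴰ Y) *ᴰ e} {F} (symᴰ {(X *ᴰ Y) *ᴰ e} {X *ᴰ (Y *ᴰ e)} (*ᴰ-assoc X Y e))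
                (transᴰ {(X *ᴰ Y) *ᴰ e} {π *ᴰ e} {F} (*ᴰ-congʳ {e} {X *ᴰ Y} {π} xy≈π) πe≈f)))
        where
        X Y : DPoly
        X = x , x-fin
        Y = y , y-fin
      ...   | no _ | yes l≡1 = inj₂ (constant-divisor-unit Y (X *ᴰ e) (degree-1 λ′ l≡1)
              (transᴰ {Y *ᴰ (X *ᴰ e)} {(Y *ᴰ X) *ᴰ e} {F} (symᴰ {(Y *ᴰ X) *ᴰ e} {Y *ᴰ (X *ᴰ e)} (*ᴰ-assoc Y X e))
                (transᴰ {(Y *ᴰ X) *ᴰ e} {π *ᴰ e} {F} (*ᴰ-congʳ {e} {Y *ᴰ X} {π}
                  (transᴰ {Y *ᴰ X} {X *ᴰ Y} {π} (*ᴰ-comm Y X) xy≈π)) πe≈f)))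
        where
        X Y : DPoly
        X = x , x-fin
        Y = y , y-fin
      ...   | no k≢1 | no l≢1 = ⊥-elim (split {X} {Y}
              (divisor-smooth X κ (ℕ.≤-trans (ℕ.<⇒≤ k<d) d≤n)) (divisor-smooth Y λ′ (ℕ.≤-trans (ℕ.<⇒≤ l<d) d≤n))
              (1ᴰ , 1∈ , λ i 1≤i → trans (⋆-comm (proj₁ π) oneD i 1≤i) (trans (oneD-⋆ (proj₁ π) i 1≤i) (sym (xy≈π i 1≤i))))
              [ degree-∤ X κ k<d , degree-∤ Y λ′ l<d ]′)
        where
        X Y : DPoly
        X = x , x-fin
        Y = y , y-fin
        k<d : k ℕ.< d
        k<d = ≡.subst (k ℕ.<_) kl≡d (ℕ.m<m*n k l {{ℕ.>-nonZero 1≤k}} (ℕ.≤∧≢⇒< 1≤l (l≢1 ∘ ≡.sym)))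
        l<d : l ℕ.< d
        l<d = ≡.subst (l ℕ.<_) (≡.trans (ℕ.*-comm l k) kl≡d) (ℕ.m<m*n l k {{ℕ.>-nonZero 1≤l}} (ℕ.≤∧≢⇒< 1≤k (k≢1 ∘ ≡.sym)))

    ^ᴰ∈ : ∀ {g} m → Smooth K g → Smooth K (g ^ᴰ m)
    ^ᴰ∈ zero g∈ = 1∈
    ^ᴰ∈ (suc m) g∈ = *∈ g∈ (^ᴰ∈ m g∈)

    prime-∣-power : ∀ {π g} m → IsPrime π → Smooth K g → π ∣ˢ (g ^ᴰ m) → ¬ ¬ π ∣ˢ g
    prime-∣-power zero π-prime g∈ π∣1 = ⊥-elim (IsPrime.nonunit π-prime π∣1)
    prime-∣-power (suc m) π-prime g∈ π∣gᵐ = do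
      inj₂ π∣gᵐ⁻¹ ← IsPrime.split π-prime g∈ (^ᴰ∈ m g∈) π∣gᵐ
        where inj₁ π∣g → return π∣g
      prime-∣-power m π-prime g∈ π∣gᵐ⁻¹

    -- The argument compares primes of the stage `Smooth K`, while `SquareFreeD` concerns
    -- irreducibles of the whole ring; `prime⇒irreducible` converts a repeated prime of `F` into a
    -- forbidden factor.
    squareFree-∣ : ∀ {g h} m → SquareFreeD f → Smooth K g → Smooth K h → F *ᴰ h ≈ᴰ g ^ᴰ m → ¬ ¬ F ∣ˢ g
    squareFree-∣ {g} {h} m sf g∈ h∈ fh≈gᵐ = do
      φ ← primeFactorial K F F∈ (λ f≈0 → proj₁ (proj₂ f-degree) (f≈0 n (proj₁ f-degree)))
      factorisation-divides {F} {g} {F} {1ᴰ} {g} φ 1∈ F∈ g∈ (oneD-⋆ f) (oneD-⋆ (proj₁ g))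
        (λ {π} π-prime π∣f → prime-∣-power m π-prime g∈ (∣-trans {π} {F} {g ^ᴰ m} π∣f (h , h∈ , fh≈gᵐ)))
        (λ {π} π-prime (t , t∈ , ππt≈f) → sf (proj₁ π)
          (prime⇒irreducible π-prime (π *ᴰ t , *∈ (IsPrime.∈S π-prime) t∈ ,
            transᴰ {π *ᴰ (π *ᴰ t)} {(π *ᴰ π) *ᴰ t} {F} (symᴰ {(π *ᴰ π) *ᴰ t} {π *ᴰ (π *ᴰ t)} (*ᴰ-assoc π π t)) ππt≈f))
          (proj₁ t , proj₂ t , ππt≈f))
      where
      open SquareFreeDivisors dirichletRing (smooth-subring K)
      open Factorisations (smooth-subring K) using (∣-trans)
      F∈ : Smooth K F
      F∈ = divisor-smooth F f-degree ℕ.≤-refl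

  squareFree-∤-power : SquareFreeD f → ∀ {g q} m → Finite g → ¬ IsZeroD g → DegreeAtMost g q → q ℕ.< n → ¬ f ∣D (g ^D m)
  squareFree-∤-power sf {g} {q} m g-fin g≉0 g≤q q<n (h , h-fin@(N , h≤N) , fh≈gᵐ) =
    squareFree-∣ K n<K {G} {H} m sf (degree<⇒smooth G (ℕ.<-trans q<n n<K) g≤q)
      (degree<⇒smooth H (s≤s (ℕ.m≤n⊔m n N)) h≤N)
      (λ i 1≤i → trans (fh≈gᵐ i 1≤i) (reflexive (≡.cong (λ a → a i) (≡.sym (^ᴰ-underlying G m)))))
      -- As `g` is nonzero, so is the cofactor `k`, and `deg g` is `n` times the positive degree of
      -- `k`, against `q < n`.
      λ { (k , _ , fk≈g) → nonzero-degree (proj₁ (proj₂ k)) (proj₂ (proj₂ k))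
            (λ k≈0 → g≉0 (transᴰ {G} {F *ᴰ k} {0ᴰ} (symᴰ {F *ᴰ k} {G} fk≈g)
              (transᴰ {F *ᴰ k} {F *ᴰ 0ᴰ} {0ᴰ} (*ᴰ-congˡ {F} {k} {0ᴰ} k≈0) (*ᴰ-zeroʳ F))))
            λ { (M , μ@(1≤M , _)) → ℕ.<⇒≱ q<n (ℕ.≤-trans (ℕ.m≤m*n n M {{ℕ.>-nonZero 1≤M}})
              (degree≤ {g} (degree-resp fk≈g (⋆-degree {f} {proj₁ k} f-degree μ)) g≤q)) } }
    where
    K : ℕ
    -- Exceeding `n` and the bound `N` of `h`, this puts `f`, `g` and the cofactor `h` into one
    -- stage.
    K = suc (n ℕ.⊔ N)
    n<K : n ℕ.< K
    n<K = s≤s (ℕ.m≤m⊔n n N)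
    G H : DPoly
    G = g , g-fin
    H = h , h-fin

  square-∣-power : ∀ (X Q H : DPoly) m → (Q *ᴰ Q) *ᴰ H ≈ᴰ F →
                   F *ᴰ (X *ᴰ (X *ᴰ (H *ᴰ ((X *ᴰ (Q *ᴰ H)) ^ᴰ m)))) ≈ᴰ (X *ᴰ (Q *ᴰ H)) ^ᴰ suc (suc m)
  square-∣-power X Q H m QQH≈F =
    transᴰ {F *ᴰ V} {((Q *ᴰ Q) *ᴰ H) *ᴰ V} {G *ᴰ (G *ᴰ W)}
      (*ᴰ-congʳ {V} {F} {(Q *ᴰ Q) *ᴰ H} (symᴰ {(Q *ᴰ Q) *ᴰ H} {F} QQH≈F))
      (square-identity X Q H W)
    where
    open SquareFreeDivisors dirichletRing (smooth-subring 0) using (square-identity)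
    G W V : DPoly
    G = X *ᴰ (Q *ᴰ H)
    W = G ^ᴰ m
    V = X *ᴰ (X *ᴰ (H *ᴰ W))

  -- For `d = deg q`, the product `q h` has degree `k = n / d`. The factor missing from `n / p` is
  -- `d / p`, whence the monomial of degree `d′`.
  repeated-factor : ∀ {q} m → 2 ≤ m → IrreducibleD q → (q ⋆ q) ∣D f →
    ∃₂ λ p r → Prime p × n ≡ p * r × p ∣ r × ∃ λ g → Finite g × HasDegree g r × f ∣D (g ^D m)
  repeated-factor {q} (suc (suc m)) (s≤s (s≤s z≤n)) (q-fin , _ , q-nonunit , _) (h , h-fin , qqh≈f) =
    p , d′ * k , p-prime , n≡p[d′k] , p∣d′k , proj₁ G , proj₂ G ,
    ⋆-degree {proj₁ X} {proj₁ QH} (monomial-degree 1≤d′ 1≉0) QH-degree ,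
    proj₁ V , proj₂ V , λ i 1≤i → trans (square-∣-power X Q H m qqh≈f i 1≤i)
      (reflexive (≡.cong (λ a → a i) (^ᴰ-underlying G (suc (suc m)))))
    where
    Q H QH : DPoly
    Q = q , q-fin
    H = h , h-fin
    QH = Q *ᴰ H
    Q[QH]≈F : Q *ᴰ QH ≈ᴰ F
    Q[QH]≈F = transᴰ {Q *ᴰ QH} {(Q *ᴰ Q) *ᴰ H} {F} (symᴰ {(Q *ᴰ Q) *ᴰ H} {Q *ᴰ QH} (*ᴰ-assoc Q Q H)) qqh≈f
    degrees : ∃₂ λ d k → HasDegree (proj₁ Q) d × HasDegree (proj₁ QH) k × d * k ≡ n
    degrees = factors-of-f Q QH Q[QH]≈F
    d k : ℕ
    d = proj₁ degrees
    k = proj₁ (proj₂ degrees)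
    Q-degree : HasDegree (proj₁ Q) d
    Q-degree = proj₁ (proj₂ (proj₂ degrees))
    QH-degree : HasDegree (proj₁ QH) k
    QH-degree = proj₁ (proj₂ (proj₂ (proj₂ degrees)))
    dk≡n : d * k ≡ n
    dk≡n = proj₂ (proj₂ (proj₂ (proj₂ degrees)))
    d∣k : d ∣ k
    -- One factor `q` remains in `q h`; hence `p ∣ d ∣ k`, which supplies the second factor `p` of
    -- `n`.
    d∣k = go (factors-of-degree Q H QH-degree)
      where
      go : (∃₂ λ d₁ l → HasDegree (proj₁ Q) d₁ × HasDegree (proj₁ H) l × d₁ * l ≡ k) → d ∣ k
      go (d₁ , l , δ , _ , d₁l≡k) = ≡.subst₂ _∣_ (degree-unique {q} δ Q-degree) d₁l≡k (ℕ.m∣m*n l)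
    2≤d : 2 ≤ d
    2≤d = ℕ.≤∧≢⇒< (proj₁ Q-degree) λ 1≡d →
      q-nonunit (constant-divisor-unit Q QH (degree-1 {q} Q-degree (≡.sym 1≡d)) Q[QH]≈F)
    p : ℕ
    p = proj₁ (prime-divisor 2≤d)
    p-prime : Prime p
    p-prime = proj₁ (proj₂ (prime-divisor 2≤d))
    p∣d : p ∣ d
    p∣d = proj₂ (proj₂ (prime-divisor 2≤d))
    d′ : ℕ
    d′ = ℕ.quotient p∣d
    d≡pd′ : d ≡ p * d′
    d≡pd′ = ℕ.m∣n⇒n≡m*quotient p∣d
    1≤d′ : 1 ≤ d′
    1≤d′ = factorʳ≥1 p d′ (proj₁ Q-degree) (≡.sym d≡pd′)
    n≡p[d′k] : n ≡ p * (d′ * k)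
    n≡p[d′k] = ≡.trans (≡.sym dk≡n) (≡.trans (≡.cong (_* k) d≡pd′) (ℕ.*-assoc p d′ k))
    p∣d′k : p ∣ d′ * k
    p∣d′k = ℕ.∣n⇒∣m*n d′ (ℕ.∣-trans p∣d d∣k)
    X G V : DPoly
    X = monomial 1# d′ , d′ , monomial-finite 1# d′
    G = X *ᴰ QH
    V = X *ᴰ (X *ᴰ (H *ᴰ (G ^ᴰ m)))

cofactor<n : ∀ {n p q} → 2 ≤ n → Prime p → n ≡ p * q → q ℕ.< n
cofactor<n {n} {p} {zero} 2≤n p-prime n≡pq = ℕ.<-trans (s≤s z≤n) 2≤n
cofactor<n {n} {p} {q@(suc _)} 2≤n p-prime n≡pq = ≡.subst (q ℕ.<_) (≡.trans (ℕ.*-comm q p) (≡.sym n≡pq))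
  (ℕ.m<m*n q p (prime≥2 p-prime))

theorem7p12 : {c ℓ : Level} (R : CommutativeRing c ℓ) → Theory.IsUFD R →
    (f : Theory.DSeries R) (n : ℕ) → Theory.Finite R f → Theory.PrimitiveD R f →
    Theory.HasDegree R f n → 2 ≤ n → NotSquareFreeℕ n →
    (m : ℕ) → 2 ≤ m →
    let
      condI = Theory.SquareFreeD R f
      condII = (p q : ℕ) → Prime p → n ≡ p * q → p ∣ q →
        (g : Theory.DSeries R) → Theory.Finite R g → ¬ Theory.IsZeroD R g →
        Theory.DegreeAtMost R g q → ¬ Theory._∣D_ R f (Theory._^D_ R g m)
      condIII = (p q : ℕ) → Prime p → n ≡ p * q → p ∣ q →
        (g : Theory.DSeries R) → Theory.Finite R g →
        Theory.HasDegree R g q → ¬ Theory._∣D_ R f (Theory._^D_ R g m)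
    in ((condI → condII) × (condII → condI)) × ((condI → condIII) × (condIII → condI))
theorem7p12 R isUFD f n f-finite f-primitive f-degree 2≤n _ m 2≤m =
  -- The cycle through (i), (ii), (iii) yields all four implications.
  (I⇒II , III⇒I ∘ II⇒III) , (II⇒III ∘ I⇒II , III⇒I)
  where
  open Theory R
  open Proof R isUFD f n f-primitive f-degree

  II III : Set _
  II = (p q : ℕ) → Prime p → n ≡ p * q → p ∣ q → (g : DSeries) → Finite g → ¬ IsZeroD g →
       DegreeAtMost g q → ¬ f ∣D (g ^D m)
  III = (p q : ℕ) → Prime p → n ≡ p * q → p ∣ q → (g : DSeries) → Finite g →
        HasDegree g q → ¬ f ∣D (g ^D m)

  I⇒II : SquareFreeD f → II
  I⇒II sf p q p-prime n≡pq _ g g-finite g≉0 g≤q =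
    squareFree-∤-power sf m g-finite g≉0 g≤q (cofactor<n 2≤n p-prime n≡pq)

  II⇒III : II → III
  II⇒III ii p q p-prime n≡pq p∣q g g-finite (1≤q , gq≉0 , g≤q) =
    ii p q p-prime n≡pq p∣q g g-finite (λ g≈0 → gq≉0 (g≈0 q 1≤q)) g≤q

  III⇒I : III → SquareFreeD f
  III⇒I iii q q-irreducible qq∣f with repeated-factor m 2≤m q-irreducible qq∣f
  ... | p , r , p-prime , n≡pr , p∣r , g , g-finite , g-degree , f∣gᵐ =
    iii p r p-prime n≡pr p∣r g g-finite g-degree f∣gᵐ
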